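{- Let $H$ be a graph with chromatic number $3$. Then there is a smallest positive integer $g$ such that $H$ is not homomorphic to the cycle $C_{2g+1}$, and for this $g$, \[ \delta_{H} = \frac{2}{2g+1}. \]
   Context: All graphs are finite and simple. A graph $G$ is homomorphic to a graph $F$ if there is a map $\varphi: V(G)\to V(F)$ with $\varphi(u)\varphi(v)\in E(F)$ for every edge $uv$ of $G$. $\delta(G)$ denotes the minimum degree and $|G|$ the number of vertices. An $n$-vertex graph is $F$-free if it contains no (not necessarily induced) subgraph isomorphic to $F$. For a graph $H$ of chromatic number $r+1$, $\delta_H$ is defined as the infimum of all $c$ with the following property: for every $\eta>0$ there is $n_0$ such that every $H$-free graph $G$ on $n\ge n_0$ vertices with $\delta(G)\ge cn$ can be made $r$-partite by deleting at most $\eta n^2$ edges (i.e. "can be made $r$-partite by deleting $o(n^2)$ edges"). -}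

module Defs where

open import Data.Nat as ℕ using (ℕ; zero; suc; _%_; _≡ᵇ_)
open import Data.Fin using (Fin; zero; suc; toℕ)
open import Data.Bool using (Bool; true; false; _∧_; _∨_; not; if_then_else_)
open import Data.Integer using (+_)
open import Data.Rational using (ℚ; _/_; _*_; _≤_; _<_; 0ℚ)
open import Data.Product using (Σ; _×_)
open import Function.Definitions using (Injective)
open import Relation.Binary.PropositionalEquality using (_≡_)
open import Relation.Nullary using (¬_)

record Graph (n : ℕ) : Set where
  field
    adj  : Fin n → Fin n → Bool
    sym  : ∀ u v → adj u v ≡ adj v u
    irr  : ∀ v → adj v v ≡ false
open Graph public

Hom : ∀ {n m} → Graph n → (Fin m → Fin m → Bool) → Set
Hom {n} {m} G R = Σ (Fin n → Fin m) λ φ →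
  ∀ u v → adj G u v ≡ true → R (φ u) (φ v) ≡ true

K : (r : ℕ) → Fin r → Fin r → Bool
K r i j = not (toℕ i ≡ᵇ toℕ j)

-- Cycle C_{suc k} adjacency: i ~ j iff j ≡ i+1 or i ≡ j+1 (mod suc k).
-- (A genuine cycle when suc k ≥ 3.)
Cyc : (k : ℕ) → Fin (suc k) → Fin (suc k) → Bool
Cyc k i j = ((suc (toℕ i) % suc k) ≡ᵇ toℕ j) ∨ ((suc (toℕ j) % suc k) ≡ᵇ toℕ i)

ChromaticNumber : ∀ {n} → Graph n → ℕ → Set
ChromaticNumber G zero = Hom G (K zero)
ChromaticNumber G (suc k) = Hom G (K (suc k)) × ¬ Hom G (K k)

Contains : ∀ {k n} → Graph k → Graph n → Set
Contains {k} {n} H G = Σ (Fin k → Fin n) λ f →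
  Injective _≡_ _≡_ f × (∀ u v → adj H u v ≡ true → adj G (f u) (f v) ≡ true)

Free : ∀ {k n} → Graph k → Graph n → Set
Free H G = ¬ Contains H G

count : ∀ {n} → (Fin n → Bool) → ℕ
count {zero} p = 0
count {suc n} p = (if p zero then 1 else 0) ℕ.+ count (λ x → p (suc x))

deg : ∀ {n} → Graph n → Fin n → ℕ
deg G v = count (adj G v)

ι : ℕ → ℚ
ι n = + n / 1

MinDegAtLeast : ∀ {n} → Graph n → ℚ → Set
MinDegAtLeast {n} G c = ∀ v → c * ι n ≤ ι (deg G v)

SubgraphOf : ∀ {n} → Graph n → Graph n → Set
SubgraphOf G' G = ∀ u v → adj G' u v ≡ true → adj G u v ≡ true

sumF : ∀ {n} → (Fin n → ℕ) → ℕ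
sumF {zero} f = 0
sumF {suc n} f = f zero ℕ.+ sumF (λ x → f (suc x))

-- number of ordered pairs (u,v) with uv ∈ E(G) ∖ E(G'),
-- i.e. twice the number of deleted edges
deletedOrdered : ∀ {n} → Graph n → Graph n → ℕ
deletedOrdered G G' = sumF (λ u → count (λ v → adj G u v ∧ not (adj G' u v)))

AlmostPartite : ∀ {n} → ℕ → Graph n → ℚ → Set
AlmostPartite {n} r G η = Σ (Graph n) λ G' →
  SubgraphOf G' G × Hom G' (K r) ×
  (ι (deletedOrdered G G') ≤ ι 2 * η * ι (n ℕ.* n))

-- the defining property of δ_H at value c (with r = χ(H) - 1):
-- for every η > 0 there is n₀ such that every H-free graph G on n ≥ n₀
-- vertices with δ(G) ≥ cn can be made r-partite by deleting ≤ η n² edges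
DeltaProp : ∀ {k} → ℕ → Graph k → ℚ → Set
DeltaProp r H c = ∀ (η : ℚ) → 0ℚ < η → Σ ℕ λ n₀ → ∀ n → n₀ ℕ.≤ n →
  (G : Graph n) → Free H G → MinDegAtLeast G c → AlmostPartite r G η

-- δ_H = t, i.e. t is the infimum of {c | DeltaProp r H c}.
-- (DeltaProp is upward closed in c, and ℚ is dense in ℝ, so this is
-- equivalent to the infimum definition.)
DeltaHIs : ∀ {k} → ℕ → Graph k → ℚ → Set
DeltaHIs r H t = (∀ c → t < c → DeltaProp r H c) × (∀ c → c < t → ¬ DeltaProp r H c)

{-# OPTIONS --safe #-}
-- Lower bound: a balanced blow-up of C_{2g+1} is H-free with minimum degree 2n/(2g+1), and in
-- every 2-colouring two consecutive parts share their majority colour, so it is far from bipartite.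
--
-- Upper bound: write h(L) for the number of closed walks of length L. If h(L) ≥ n^L / D for some
-- odd L ≤ 2g-1, then cloning vertices one at a time (Cauchy–Schwarz) produces many copies of a
-- blow-up of C_L, hence an injective copy of H. So h(L) is small for these L. A robust form of
-- the Andrásfai–Erdős–Sós argument extends this to every odd L: on average a vertex is adjacent
-- to more than two positions of a closed walk of length L ≥ 2g+1, and three such positions cut
-- off a shorter odd closed walk.
-- Finally let e be large. From a typical vertex x grow the set of vertices reached by a positive
-- density of walks of length at most j, until one step adds at most n/e vertices; colour each
-- vertex by the parity of most of its walks. Few edges leave this set, and few inside it are
-- monochromatic, since those create odd closed walks. Linear minimum degree makes a bounded
-- number of such sets cover all but few vertices.
module Submission where

open import Defs hiding (sym)
open import Data.Nat hiding (_/_)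
open import Data.Nat.Properties
open import Data.Nat.Coprimality using (Coprime)
open import Data.Nat.DivMod using (m<n⇒m%n≡m; n%n≡0; m%n<n)
open import Data.Nat.Tactic.RingSolver using (solve-∀)
import Data.Integer as ℤ
import Data.Integer.Properties as ℤ
open import Data.Rational using (mkℚ; 0ℚ; toℚᵘ; _/_; *<*)
import Data.Rational as ℚ
import Data.Rational.Properties as ℚ
open import Data.Rational.Unnormalised using (ℚᵘ; mkℚᵘ; *≤*; *<*; *≡*)
import Data.Rational.Unnormalised as ℚᵘ
import Data.Rational.Unnormalised.Properties as ℚᵘ
open import Data.Fin using (Fin; zero; suc; toℕ; _↑ˡ_; _↑ʳ_; combine; quotient)
import Data.Fin as Fin
import Data.Fin.Properties as Fin
open import Data.List using (List; []; _∷_; length)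
open import Data.Vec using (Vec; []; _∷_; lookup; _[_]≔_; _++_; allFin; tabulate)
open import Data.Vec.Properties using (lookup-++ˡ; lookup-++ʳ; lookup-allFin; lookup∘tabulate; lookup∘update; lookup∘update′)
open import Data.Bool using (Bool; true; false; _∧_; _∨_; not; if_then_else_; _xor_)
import Data.Bool.Properties as Bool
open import Data.Bool.Properties using (T-∨; T-≡)
open import Data.Product
open import Data.Sum
open import Data.Empty
open import Function
open import Relation.Nullary
open import Relation.Nullary.Decidable using (dec-true; dec-false; map′; _→-dec_)
open import Relation.Binary.PropositionalEquality hiding ([_])
open ≤-Reasoning

-- Sums over Fin n and matrices

-- The obstacle is that an `H`-free graph may well contain short odd cycles: they are merely few.
-- Nothing can be excluded outright, so each classical existence step is replaced by a count of
-- walks, and each use of it costs a constant factor. The descent needs three marked positions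
-- because two do not suffice: they cut an odd closed walk into an odd and an even arc, and if the
-- even arc has length 2, closing the odd arc through the common neighbour gives back the original
-- length. With three positions and length at least 5, some odd arc leaves at least four steps. This
-- is the origin of the 2 in 2/(2g+1): the average number of marks has to exceed two. Lazy walks
-- serve the last stage: resting makes the reached sets increase with `j` and brings walks of all
-- lengths up to `j` under one normalisation n^j. Estimates are cross-multiplied in ℕ throughout;
-- `e * X ≤ n` stands for X ≤ n/e.

⟦_⟧ : Bool → ℕ
⟦ b ⟧ = if b then 1 else 0

⟦⟧≤1 : ∀ b → ⟦ b ⟧ ≤ 1
⟦⟧≤1 true  = ≤-refl
⟦⟧≤1 false = z≤n

sum-cong : ∀ {n} {f g : Fin n → ℕ} → (∀ x → f x ≡ g x) → sumF f ≡ sumF g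
sum-cong {zero}  h = refl
sum-cong {suc n} h = cong₂ _+_ (h zero) (sum-cong (h ∘ suc))

sum-mono : ∀ {n} {f g : Fin n → ℕ} → (∀ x → f x ≤ g x) → sumF f ≤ sumF g
sum-mono {zero}  h = z≤n
sum-mono {suc n} h = +-mono-≤ (h zero) (sum-mono (h ∘ suc))

interchange : ∀ a b c d → (a + b) + (c + d) ≡ (a + c) + (b + d)
interchange = solve-∀

sum-+ : ∀ {n} (f g : Fin n → ℕ) → sumF (λ x → f x + g x) ≡ sumF f + sumF g
sum-+ {zero}  f g = refl
sum-+ {suc n} f g = trans (cong (f zero + g zero +_) (sum-+ (f ∘ suc) (g ∘ suc)))
  (interchange (f zero) (g zero) (sumF (f ∘ suc)) (sumF (g ∘ suc)))

sum-*ˡ : ∀ {n} k (f : Fin n → ℕ) → sumF (λ x → k * f x) ≡ k * sumF f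
sum-*ˡ {zero}  k f = sym (*-zeroʳ k)
sum-*ˡ {suc n} k f = trans (cong (k * f zero +_) (sum-*ˡ k (f ∘ suc)))
  (sym (*-distribˡ-+ k (f zero) (sumF (f ∘ suc))))

sum-*ʳ : ∀ {n} k (f : Fin n → ℕ) → sumF (λ x → f x * k) ≡ sumF f * k
sum-*ʳ k f = trans (sum-cong λ x → *-comm (f x) k) (trans (sum-*ˡ k f) (*-comm k (sumF f)))

sum-const : ∀ n k → sumF {n} (λ _ → k) ≡ n * k
sum-const zero    k = refl
sum-const (suc n) k = cong (k +_) (sum-const n k)

sum-0 : ∀ n → sumF {n} (λ _ → 0) ≡ 0
sum-0 n = trans (sum-const n 0) (*-zeroʳ n)

sum-≤ : ∀ {n k} {f : Fin n → ℕ} → (∀ x → f x ≤ k) → sumF f ≤ n * k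
sum-≤ {n} {k} h = ≤-trans (sum-mono h) (≤-reflexive (sum-const n k))

sum-swap : ∀ {m n} (f : Fin m → Fin n → ℕ) →
  sumF (λ x → sumF (f x)) ≡ sumF (λ y → sumF (λ x → f x y))
sum-swap {zero}  {n} f = sym (sum-0 n)
sum-swap {suc m} f = trans (cong (sumF (f zero) +_) (sum-swap (f ∘ suc)))
  (sym (sum-+ (f zero) (λ y → sumF (λ x → f (suc x) y))))

term≤sum : ∀ {n} (f : Fin n → ℕ) x → f x ≤ sumF f
term≤sum f zero    = m≤m+n _ _
term≤sum f (suc x) = ≤-trans (term≤sum (f ∘ suc) x) (m≤n+m _ _)

sum-< : ∀ {n} (f g : Fin n → ℕ) → sumF f < sumF g → ∃ λ x → f x < g x
sum-< {suc n} f g lt with f zero <? g zero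
... | yes p = zero , p
... | no ¬p with sum-< (f ∘ suc) (g ∘ suc) (≰⇒> λ q → <⇒≱ lt (+-mono-≤ (≮⇒≥ ¬p) q))
...   | x , p = suc x , p

count-sum : ∀ {n} (p : Fin n → Bool) → count p ≡ sumF (λ x → ⟦ p x ⟧)
count-sum {zero}  p = refl
count-sum {suc n} p = cong (⟦ p zero ⟧ +_) (count-sum (p ∘ suc))

-- Cauchy-Schwarz over the natural numbers.

cauchy-schwarz₂ : ∀ a b → a * b + a * b ≤ a * a + b * b
cauchy-schwarz₂ a b with ≤-total a b
... | inj₁ a≤b with m≤n⇒∃[o]m+o≡n a≤b
...   | o , refl = ≤-trans (m≤m+n _ (o * o)) (≤-reflexive (lem a o))
  where lem : ∀ a o → a * (a + o) + a * (a + o) + o * o ≡ a * a + (a + o) * (a + o)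
        lem = solve-∀
cauchy-schwarz₂ a b | inj₂ b≤a with m≤n⇒∃[o]m+o≡n b≤a
... | o , refl = ≤-trans (m≤m+n _ (o * o)) (≤-reflexive (lem b o))
  where lem : ∀ b o → (b + o) * b + (b + o) * b + o * o ≡ (b + o) * (b + o) + b * b
        lem = solve-∀

sum-*-sum : ∀ {n} (f g : Fin n → ℕ) → sumF f * sumF g ≡ sumF (λ x → sumF (λ y → f x * g y))
sum-*-sum f g = trans (sym (sum-*ʳ (sumF g) f)) (sum-cong λ x → sym (sum-*ˡ (f x) g))

cauchy-schwarz : ∀ {n} (f : Fin n → ℕ) → sumF f * sumF f ≤ n * sumF (λ x → f x * f x)
cauchy-schwarz {n} f = *-cancelˡ-≤ 2 (begin
  2 * (S * S)               ≡⟨ dbl (S * S) ⟩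
  S * S + S * S             ≡⟨ cong₂ _+_ (sum-*-sum f f) (sum-*-sum f f) ⟩
  sumF (λ x → sumF (λ y → f x * f y)) + sumF (λ x → sumF (λ y → f x * f y))
    ≡⟨ sum-+ (λ x → sumF (λ y → f x * f y)) _ ⟨
  sumF (λ x → sumF (λ y → f x * f y) + sumF (λ y → f x * f y))
    ≡⟨ sum-cong (λ x → sum-+ (λ y → f x * f y) _) ⟨
  sumF (λ x → sumF (λ y → f x * f y + f x * f y))
    ≤⟨ sum-mono (λ x → sum-mono λ y → cauchy-schwarz₂ (f x) (f y)) ⟩
  sumF (λ x → sumF (λ y → f x * f x + f y * f y))
    ≡⟨ sum-cong (λ x → trans (sum-+ (λ _ → f x * f x) (λ y → f y * f y)) (cong (_+ Q) (sum-const n (f x * f x)))) ⟩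
  sumF (λ x → n * (f x * f x) + Q)
    ≡⟨ trans (sum-+ (λ x → n * (f x * f x)) (λ _ → Q)) (cong₂ _+_ (sum-*ˡ n (λ x → f x * f x)) (sum-const n Q)) ⟩
  n * Q + n * Q ≡⟨ dbl (n * Q) ⟨
  2 * (n * Q) ∎)
  where
  S = sumF f
  Q = sumF (λ x → f x * f x)
  dbl : ∀ a → 2 * a ≡ a + a
  dbl = solve-∀

-- The identity matrix, matrix products and traces.

δ : ∀ {n} → Fin n → Fin n → ℕ
δ x y = ⟦ does (x Fin.≟ y) ⟧

δ-refl : ∀ {n} (x : Fin n) → δ x x ≡ 1
δ-refl x = cong ⟦_⟧ (dec-true (x Fin.≟ x) refl)

sum-δˡ : ∀ {n} (x : Fin n) (f : Fin n → ℕ) → sumF (λ z → δ x z * f z) ≡ f x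
sum-δˡ {suc n} zero f = trans (cong₂ _+_ (+-identityʳ (f zero)) (sum-0 n)) (+-identityʳ _)
sum-δˡ {suc n} (suc x) f = trans (sum-cong λ z → cong (_* f (suc z)) (lem z)) (sum-δˡ x (f ∘ suc))
  where
  lem : ∀ z → δ (suc x) (suc z) ≡ δ x z
  lem z with x Fin.≟ z
  ... | yes _ = refl
  ... | no _  = refl

sum-δ : ∀ {n} (x : Fin n) → sumF (δ x) ≡ 1
sum-δ x = trans (sum-cong λ i → sym (*-identityʳ (δ x i))) (sum-δˡ x (λ _ → 1))

δ-sym : ∀ {n} (x y : Fin n) → δ x y ≡ δ y x
δ-sym x y with x Fin.≟ y | y Fin.≟ x
... | yes _ | yes _ = refl
... | no _ | no _ = refl
... | yes p | no q = ⊥-elim (q (sym p))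
... | no p | yes q = ⊥-elim (p (sym q))

Mat : ℕ → Set
Mat n = Fin n → Fin n → ℕ

module _ {n : ℕ} where
  infixr 7 _⊗_
  infix 4 _≈_

  _≈_ : Mat n → Mat n → Set
  M ≈ N = ∀ x y → M x y ≡ N x y

  _⊗_ : Mat n → Mat n → Mat n
  (M ⊗ N) x y = sumF λ z → M x z * N z y

  tr : Mat n → ℕ
  tr M = sumF λ x → M x x

  ⊗-cong : ∀ {M M′ N N′} → M ≈ M′ → N ≈ N′ → M ⊗ N ≈ M′ ⊗ N′
  ⊗-cong p q x y = sum-cong λ z → cong₂ _*_ (p x z) (q z y)

  ⊗-congʳ : ∀ M {N N′} → N ≈ N′ → M ⊗ N ≈ M ⊗ N′
  ⊗-congʳ M = ⊗-cong {M} (λ _ _ → refl)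

  tr-cong : ∀ {M M′} → M ≈ M′ → tr M ≡ tr M′
  tr-cong p = sum-cong λ x → p x x

  ⊗-assoc : ∀ M N P → (M ⊗ N) ⊗ P ≈ M ⊗ (N ⊗ P)
  ⊗-assoc M N P x y = begin-equality
    sumF (λ z → sumF (λ w → M x w * N w z) * P z y)
      ≡⟨ sum-cong (λ z → sum-*ʳ (P z y) (λ w → M x w * N w z)) ⟨
    sumF (λ z → sumF (λ w → M x w * N w z * P z y))
      ≡⟨ sum-swap (λ z w → M x w * N w z * P z y) ⟩
    sumF (λ w → sumF (λ z → M x w * N w z * P z y))
      ≡⟨ sum-cong (λ w → trans (sum-cong λ z → *-assoc (M x w) (N w z) (P z y)) (sum-*ˡ (M x w) (λ z → N w z * P z y))) ⟩
    sumF (λ w → M x w * sumF (λ z → N w z * P z y)) ∎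

  ⊗-distribˡ : ∀ M N P → M ⊗ (λ x y → N x y + P x y) ≈ (λ x y → (M ⊗ N) x y + (M ⊗ P) x y)
  ⊗-distribˡ M N P x y = trans (sum-cong λ z → *-distribˡ-+ (M x z) (N z y) (P z y)) (sum-+ (λ z → M x z * N z y) (λ z → M x z * P z y))

  ⊗-scaleʳ : ∀ M N k → M ⊗ (λ x y → k * N x y) ≈ λ x y → k * (M ⊗ N) x y
  ⊗-scaleʳ M N k x y = trans (sum-cong λ z → lem (M x z) k (N z y)) (sum-*ˡ k (λ z → M x z * N z y))
    where lem : ∀ a k b → a * (k * b) ≡ k * (a * b)
          lem = solve-∀

  tr-cyc : ∀ M N → tr (M ⊗ N) ≡ tr (N ⊗ M)
  tr-cyc M N = trans (sum-swap (λ x z → M x z * N z x))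
    (sum-cong λ z → sum-cong λ x → *-comm (M x z) (N z x))

  tr-+ : ∀ (M N : Mat n) → tr (λ x y → M x y + N x y) ≡ tr M + tr N
  tr-+ M N = sum-+ (λ x → M x x) (λ x → N x x)

  δ-⊗ : ∀ M → δ ⊗ M ≈ M
  δ-⊗ M x y = sum-δˡ x (λ z → M z y)

  ⊗-δ : ∀ M → M ⊗ δ ≈ M
  ⊗-δ M x y = trans (sum-cong λ z → trans (*-comm (M x z) _) (cong (_* M x z) (δ-sym z y))) (sum-δˡ y (M x))

  ⊗-mono : ∀ {M N N′} → (∀ x y → N x y ≤ N′ x y) → ∀ x y → (M ⊗ N) x y ≤ (M ⊗ N′) x y
  ⊗-mono {M} h x y = sum-mono λ z → *-monoʳ-≤ (M x z) (h z y)

-- Walks and marked walks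

module Walks {n : ℕ} (G : Graph n) where

  A : Mat n
  A x y = ⟦ adj G x y ⟧

  A-sym : ∀ x y → A x y ≡ A y x
  A-sym x y = cong ⟦_⟧ (Graph.sym G x y)

  A≤1 : ∀ x y → A x y ≤ 1
  A≤1 x y = ⟦⟧≤1 (adj G x y)

  W : ℕ → Mat n
  W zero    = δ
  W (suc j) = A ⊗ W j

  h : ℕ → ℕ
  h L = tr (W L)

  W-+ : ∀ i j → W i ⊗ W j ≈ W (i + j)
  W-+ zero    j = δ-⊗ (W j)
  W-+ (suc i) j x y = trans (⊗-assoc A (W i) (W j) x y) (⊗-congʳ A (W-+ i j) x y)

  W-1 : W 1 ≈ A
  W-1 = ⊗-δ A

  W-bound : ∀ j x y → W (suc j) x y ≤ n ^ j
  W-bound zero    x y = ≤-trans (≤-reflexive (W-1 x y)) (A≤1 x y)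
  W-bound (suc j) x y = sum-≤ λ z → ≤-trans (*-mono-≤ (A≤1 x z) (W-bound j z y)) (≤-reflexive (+-identityʳ _))

  module Marked (v : Fin n) where

    infixr 8 D∙_
    -- Left multiplication by the diagonal 0/1 matrix of the neighbourhood of `v`: it keeps the
    -- walks that start at a neighbour of `v`.
    D∙_ : Mat n → Mat n
    (D∙ M) x y = A v x * M x y

    -- mark r L x y counts the walks of length L from x to y, each with a choice of
    -- r positions (the last one excluded) at which the walk visits a neighbour of v.
    mark : ℕ → ℕ → Mat n
    mark zero    L           = W L
    mark (suc r) zero    x y = 0
    mark (suc r) (suc L) x y = (D∙ (A ⊗ mark r L)) x y + (A ⊗ mark (suc r) L) x y

    mark₁≤₂ : ∀ L x y → mark 1 L x y ≤ mark 0 L x y + mark 2 L x y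
    mark₁≤₂ zero    x y = z≤n
    mark₁≤₂ (suc L) x y with adj G v x
    ... | true  = begin
      a₀ + 0 + a₁         ≤⟨ m≤m+n _ a₂ ⟩
      a₀ + 0 + a₁ + a₂    ≡⟨ lem a₀ a₁ a₂ ⟩
      a₀ + (a₁ + 0 + a₂)  ∎
      where a₀ = (A ⊗ W L) x y
            a₁ = (A ⊗ mark 1 L) x y
            a₂ = (A ⊗ mark 2 L) x y
            lem : ∀ a b c → a + 0 + b + c ≡ a + (b + 0 + c)
            lem = solve-∀
    ... | false = ≤-trans (⊗-mono {M = A} (mark₁≤₂ L) x y) (≤-reflexive (⊗-distribˡ A (mark 0 L) (mark 2 L) x y))

    -- Pascal's rule turns m ≤ 2 + C(m,3) into the previous inequality m ≤ 1 + C(m,2).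
    mark₁≤₃ : ∀ L x y → mark 1 L x y ≤ 2 * mark 0 L x y + mark 3 L x y
    mark₁≤₃ zero    x y = z≤n
    mark₁≤₃ (suc L) x y with adj G v x
    ... | true  = begin
      a₀ + 0 + a₁              ≤⟨ +-monoʳ-≤ (a₀ + 0) (⊗-mono {M = A} (mark₁≤₂ L) x y) ⟩
      a₀ + 0 + (A ⊗ (λ x y → mark 0 L x y + mark 2 L x y)) x y
                               ≡⟨ cong (a₀ + 0 +_) (⊗-distribˡ A (mark 0 L) (mark 2 L) x y) ⟩
      a₀ + 0 + (a₀ + a₂)       ≤⟨ m≤m+n _ a₃ ⟩
      a₀ + 0 + (a₀ + a₂) + a₃  ≡⟨ lem a₀ a₂ a₃ ⟩
      2 * a₀ + (a₂ + 0 + a₃)   ∎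
      where a₀ = (A ⊗ W L) x y
            a₁ = (A ⊗ mark 1 L) x y
            a₂ = (A ⊗ mark 2 L) x y
            a₃ = (A ⊗ mark 3 L) x y
            lem : ∀ a b c → a + 0 + (a + b) + c ≡ 2 * a + (b + 0 + c)
            lem = solve-∀
    ... | false = ≤-trans (⊗-mono {M = A} (mark₁≤₃ L) x y) (≤-reflexive
        (trans (⊗-distribˡ A (λ x y → 2 * mark 0 L x y) (mark 3 L) x y)
               (cong (_+ (A ⊗ mark 3 L) x y) (⊗-scaleʳ A (mark 0 L) 2 x y))))

    D-⊗ : ∀ M N → (D∙ M) ⊗ N ≈ D∙ (M ⊗ N)
    D-⊗ M N x y = trans (sum-cong λ z → *-assoc (A v x) (M x z) (N z y)) (sum-*ˡ (A v x) (λ z → M x z * N z y))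

    D-cong : ∀ {M N} → M ≈ N → D∙ M ≈ D∙ N
    D-cong p x y = cong (A v x *_) (p x y)

  open Marked public

  -- Double counting: each of the L positions of a walk is a neighbour of deg many vertices `v`, and
  -- every degree is at least P/Q.
  mark₁-lower : ∀ P Q → (∀ z → P ≤ Q * deg G z) → ∀ L x y →
    L * P * W L x y ≤ Q * sumF (λ v → mark v 1 L x y)
  mark₁-lower P Q hyp zero x y = z≤n
  mark₁-lower P Q hyp (suc L) x y = begin
    (P + L * P) * W (suc L) x y                      ≡⟨ *-distribʳ-+ (W (suc L) x y) P (L * P) ⟩
    P * W (suc L) x y + L * P * W (suc L) x y        ≤⟨ +-mono-≤ first second ⟩
    Q * sumF (λ v → (D∙_ v (A ⊗ W L)) x y) + Q * sumF (λ v → (A ⊗ mark v 1 L) x y)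
      ≡⟨ *-distribˡ-+ Q (sumF (λ v → (D∙_ v (A ⊗ W L)) x y)) _ ⟨
    Q * (sumF (λ v → (D∙_ v (A ⊗ W L)) x y) + sumF (λ v → (A ⊗ mark v 1 L) x y))
      ≡⟨ cong (Q *_) (sum-+ (λ v → (D∙_ v (A ⊗ W L)) x y) (λ v → (A ⊗ mark v 1 L) x y)) ⟨
    Q * sumF (λ v → mark v 1 (suc L) x y)            ∎
    where
    degree : sumF (λ v → A v x) ≡ deg G x
    degree = trans (sum-cong λ v → A-sym v x) (sym (count-sum (adj G x)))
    first : P * W (suc L) x y ≤ Q * sumF (λ v → A v x * W (suc L) x y)
    first = begin
      P * W (suc L) x y                     ≤⟨ *-monoˡ-≤ (W (suc L) x y) (hyp x) ⟩
      Q * deg G x * W (suc L) x y           ≡⟨ *-assoc Q _ _ ⟩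
      Q * (deg G x * W (suc L) x y)         ≡⟨ cong (λ d → Q * (d * W (suc L) x y)) degree ⟨
      Q * (sumF (λ v → A v x) * W (suc L) x y) ≡⟨ cong (Q *_) (sum-*ʳ (W (suc L) x y) (λ v → A v x)) ⟨
      Q * sumF (λ v → A v x * W (suc L) x y) ∎
    second : L * P * W (suc L) x y ≤ Q * sumF (λ v → (A ⊗ mark v 1 L) x y)
    second = begin
      L * P * (A ⊗ W L) x y                     ≡⟨ ⊗-scaleʳ A (W L) (L * P) x y ⟨
      (A ⊗ (λ x y → L * P * W L x y)) x y       ≤⟨ ⊗-mono {M = A} (mark₁-lower P Q hyp L) x y ⟩
      (A ⊗ (λ x y → Q * sumF (λ v → mark v 1 L x y))) x y ≡⟨ ⊗-scaleʳ A (λ x y → sumF (λ v → mark v 1 L x y)) Q x y ⟩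
      Q * (A ⊗ (λ x y → sumF (λ v → mark v 1 L x y))) x y
        ≡⟨ cong (Q *_) (sum-cong λ z → sym (sum-*ˡ (A x z) (λ v → mark v 1 L z y))) ⟩
      Q * sumF (λ z → sumF (λ v → A x z * mark v 1 L z y))
        ≡⟨ cong (Q *_) (sum-swap (λ z v → A x z * mark v 1 L z y)) ⟩
      Q * sumF (λ v → (A ⊗ mark v 1 L) x y) ∎

  -- Cuts a marked walk at its first mark, reached after `i` steps, with `j` steps left after the
  -- step that follows the mark; the factor L counts the possible places. `K` holds what has already
  -- been cut off on the left and absorbs the unmarked steps during the induction.
  split-mark : ∀ d β r L (K : Fin n → Mat n) →
    (∀ i j → i + suc j ≡ L → d * sumF (λ v → tr (K v ⊗ (W i ⊗ D∙_ v (A ⊗ mark v r j)))) ≤ β) →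
    d * sumF (λ v → tr (K v ⊗ mark v (suc r) L)) ≤ L * β
  split-mark d β r zero K hyp = ≤-reflexive (trans (cong (d *_)
    (trans (sum-cong λ v → trans (sum-cong λ x → trans (sum-cong λ z → *-zeroʳ (K v x z)) (sum-0 n)) (sum-0 n)) (sum-0 n))) (*-zeroʳ d))
  split-mark d β r (suc L) K hyp = begin
    d * sumF (λ v → tr (K v ⊗ mark v (suc r) (suc L)))
      ≡⟨ cong (d *_) (trans (sum-cong λ v → trans (tr-cong (⊗-distribˡ (K v) (N v) (N′ v))) (tr-+ (K v ⊗ N v) (K v ⊗ N′ v)))
                            (sum-+ (λ v → tr (K v ⊗ N v)) (λ v → tr (K v ⊗ N′ v)))) ⟩
    d * (sumF (λ v → tr (K v ⊗ N v)) + sumF (λ v → tr (K v ⊗ N′ v)))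
      ≡⟨ *-distribˡ-+ d (sumF (λ v → tr (K v ⊗ N v))) _ ⟩
    d * sumF (λ v → tr (K v ⊗ N v)) + d * sumF (λ v → tr (K v ⊗ N′ v))
      ≤⟨ +-mono-≤ first second ⟩
    β + L * β ∎
    where
    N N′ : Fin n → Mat n
    N v  = D∙_ v (A ⊗ mark v r L)
    N′ v = A ⊗ mark v (suc r) L
    first : d * sumF (λ v → tr (K v ⊗ N v)) ≤ β
    first = ≤-trans (≤-reflexive (cong (d *_) (sum-cong λ v → tr-cong (⊗-congʳ (K v) (λ x y → sym (δ-⊗ (N v) x y))))))
      (hyp 0 L refl)
    second : d * sumF (λ v → tr (K v ⊗ N′ v)) ≤ L * β
    second = ≤-trans (≤-reflexive (cong (d *_) (sum-cong λ v → tr-cong (λ x y → sym (⊗-assoc (K v) A (mark v (suc r) L) x y)))))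
      (split-mark d β r L (λ v → K v ⊗ A) λ i j eq → ≤-trans (≤-reflexive (cong (d *_) (sum-cong λ v →
         tr-cong (λ x y → trans (⊗-assoc (K v) A (W i ⊗ D∙_ v (A ⊗ mark v r j)) x y)
            (⊗-congʳ (K v) (λ x y → sym (⊗-assoc A (W i) (D∙_ v (A ⊗ mark v r j)) x y)) x y)))))
         (hyp (suc i) j (cong suc eq)))

-- The Andrásfai–Erdős–Sós descent

data Halved : ℕ → Set where
  even : ∀ s → Halved (2 * s)
  odd  : ∀ s → Halved (suc (2 * s))

halve : ∀ m → Halved m
halve zero = even 0
halve (suc m) with halve m
... | even s = odd s
... | odd s  = subst Halved (*-suc 2 s) (even (suc s))

odd-injective : ∀ {s t} → suc (2 * s) ≡ suc (2 * t) → s ≡ t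
odd-injective {s} {t} eq = *-cancelˡ-≡ s t 2 (suc-injective eq)

-- An odd arc a of a closed walk of length 2k+1 whose ends share the neighbour v closes up,
-- through v, to an odd closed walk of length a+2; the bound on s says that a+2 < 2k+1.
ShortOdd : ℕ → ℕ → Set
ShortOdd k a = ∃ λ s → a ≡ suc (2 * s) × suc s < k

private
  one-odd : ∀ k s t u → 1 ≤ t → 1 ≤ u → suc (2 * s) + (2 * t + 2 * u) ≡ suc (2 * k) → ShortOdd k (suc (2 * s))
  one-odd k s t u 1≤t 1≤u eq = s , refl , (begin
      2 + s       ≤⟨ +-monoˡ-≤ s (+-mono-≤ 1≤t 1≤u) ⟩
      t + u + s   ≡⟨ +-comm (t + u) s ⟩
      s + (t + u) ≡⟨ odd-injective (trans (sym (lem s t u)) eq) ⟩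
      k ∎)
    where lem : ∀ s t u → suc (2 * s) + (2 * t + 2 * u) ≡ suc (2 * (s + (t + u)))
          lem = solve-∀

  nonzero-even : ∀ t → 1 ≤ 2 * t → 1 ≤ t
  nonzero-even (suc t) _ = s≤s z≤n

-- The number of odd arcs is one or three. If it is one, the other two are even and positive, so
-- they leave at least four steps. If all are odd and the first has length 1, it works because k ≥
-- 2; if the first has length at least 3, then it and the third leave at least four steps to the
-- second.
short-odd-arc : ∀ k a b c → 2 ≤ k → 1 ≤ a → 1 ≤ b → 1 ≤ c → a + (b + c) ≡ suc (2 * k) →
  ShortOdd k a ⊎ ShortOdd k b ⊎ ShortOdd k c
short-odd-arc k a b c 2≤k 1≤a 1≤b 1≤c eq with halve a | halve b | halve c
... | even s | even t | even u = ⊥-elim (even≢odd (s + (t + u)) k (trans (lem s t u) eq))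
  where lem : ∀ s t u → 2 * (s + (t + u)) ≡ 2 * s + (2 * t + 2 * u)
        lem = solve-∀
... | even s | odd t | odd u = ⊥-elim (even≢odd (suc (s + (t + u))) k (trans (lem s t u) eq))
  where lem : ∀ s t u → 2 * suc (s + (t + u)) ≡ 2 * s + (suc (2 * t) + suc (2 * u))
        lem = solve-∀
... | odd s | even t | odd u = ⊥-elim (even≢odd (suc (s + (t + u))) k (trans (lem s t u) eq))
  where lem : ∀ s t u → 2 * suc (s + (t + u)) ≡ suc (2 * s) + (2 * t + suc (2 * u))
        lem = solve-∀
... | odd s | odd t | even u = ⊥-elim (even≢odd (suc (s + (t + u))) k (trans (lem s t u) eq))
  where lem : ∀ s t u → 2 * suc (s + (t + u)) ≡ suc (2 * s) + (suc (2 * t) + 2 * u)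
        lem = solve-∀
... | odd s | even t | even u = inj₁ (one-odd k s t u (nonzero-even t 1≤b) (nonzero-even u 1≤c) eq)
... | even s | odd t | even u = inj₂ (inj₁ (one-odd k t u s (nonzero-even u 1≤c) (nonzero-even s 1≤a) (trans (lem (2 * s) (suc (2 * t)) (2 * u)) eq)))
  where lem : ∀ a b c → b + (c + a) ≡ a + (b + c)
        lem = solve-∀
... | even s | even t | odd u = inj₂ (inj₂ (one-odd k u s t (nonzero-even s 1≤a) (nonzero-even t 1≤b) (trans (lem (2 * s) (2 * t) (suc (2 * u))) eq)))
  where lem : ∀ a b c → c + (a + b) ≡ a + (b + c)
        lem = solve-∀
... | odd s | odd t | odd u with s ≤? 0
...   | yes s≤0 = inj₁ (s , refl , ≤-trans (s≤s (s≤s s≤0)) 2≤k)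
...   | no s≰0 = inj₂ (inj₁ (t , refl , (begin
      2 + t                 ≤⟨ +-monoˡ-≤ t (s≤s (≰⇒> s≰0)) ⟩
      suc s + t             ≤⟨ m≤m+n _ u ⟩
      suc s + t + u         ≡⟨ odd-injective (trans (sym (lem s t u)) eq) ⟩
      k                     ∎)))
  where lem : ∀ s t u → suc (2 * s) + (suc (2 * t) + suc (2 * u)) ≡ suc (2 * (suc s + t + u))
        lem = solve-∀

-- Passing from the shorter odd lengths to 2k+1 loses a factor E(2k+1)³. This is the constant to
-- demand at the shortest lengths so that `d` survives all the losses.
amplify : ℕ → ℕ → ℕ → ℕ
amplify E zero    d = d
amplify E (suc k) d = amplify E k (E * (suc (2 * k) * (suc (2 * k) * suc (2 * k))) * d)

d≤scaled : ∀ E k d → 1 ≤ E → d ≤ E * (suc (2 * k) * (suc (2 * k) * suc (2 * k))) * d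
d≤scaled E k d 1≤E = ≤-trans (≤-reflexive (sym (+-identityʳ d))) (*-monoˡ-≤ d (*-mono-≤ 1≤E (s≤s z≤n)))

d≤amplify : ∀ E k d → 1 ≤ E → d ≤ amplify E k d
d≤amplify E zero    d 1≤E = ≤-refl
d≤amplify E (suc k) d 1≤E = ≤-trans (d≤scaled E k d 1≤E) (d≤amplify E k _ 1≤E)

module Descent {n : ℕ} (G : Graph n) where
  open Walks G

  ≈-trans : ∀ {M N P : Mat n} → M ≈ N → N ≈ P → M ≈ P
  ≈-trans p q x y = trans (p x y) (q x y)

  ≈-sym : ∀ {M N : Mat n} → M ≈ N → N ≈ M
  ≈-sym p x y = sym (p x y)

  -- The three marks cut a closed walk into arcs of lengths a, b and c.
  triple : Fin n → ℕ → ℕ → ℕ → ℕ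
  triple v a b c = tr (D∙_ v (W a) ⊗ (D∙_ v (W b) ⊗ D∙_ v (W c)))

  triple-cyc : ∀ v a b c → triple v a b c ≡ triple v b c a
  triple-cyc v a b c = trans (tr-cyc (D∙_ v (W a)) (D∙_ v (W b) ⊗ D∙_ v (W c)))
    (tr-cong (⊗-assoc (D∙_ v (W b)) (D∙_ v (W c)) (D∙_ v (W a))))

  -- The arc of length `a` together with the two edges from its ends to `v` is a closed walk of
  -- length a+2. The remaining mark has at most n places, its adjacency to `v` is estimated by 1,
  -- and the other two arcs are bounded by `W-bound`.
  triple-bound : ∀ a b c → sumF (λ v → triple v a (suc b) (suc c)) ≤ h (2 + a) * (n * (n ^ b * n ^ c))
  triple-bound a b c = begin
    sumF (λ v → triple v a (suc b) (suc c))
      ≤⟨ sum-mono (λ v → sum-mono λ p → sum-mono λ q → *-monoʳ-≤ (A v p * W a p q)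
           (sum-≤ λ r → ≤-trans (*-mono-≤ (*-monoʳ-≤ (A v q) (W-bound b q r)) (*-mono-≤ (A≤1 v r) (W-bound c r p)))
                                 (≤-reflexive (lem₁ (A v q) (n ^ b) (n ^ c))))) ⟩
    sumF (λ v → sumF λ p → sumF λ q → A v p * W a p q * (n * (A v q * κ₀)))
      ≡⟨ sum-cong (λ v → sum-cong λ p → trans (sum-cong λ q → trans (lem₂ (A v p) (W a p q) n (A v q) κ₀)
            (cong (λ t → A v p * (W a p q * t) * κ) (A-sym v q))) (sum-*ʳ κ (λ q → A v p * (W a p q * A q v)))) ⟩
    sumF (λ v → sumF λ p → sumF (λ q → A v p * (W a p q * A q v)) * κ)
      ≡⟨ sum-cong (λ v → trans (sum-*ʳ κ (λ p → sumF (λ q → A v p * (W a p q * A q v))))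
            (cong (_* κ) (sum-cong λ p → sum-*ˡ (A v p) (λ q → W a p q * A q v)))) ⟩
    sumF (λ v → (A ⊗ (W a ⊗ A)) v v * κ)
      ≡⟨ sum-*ʳ κ (λ v → (A ⊗ (W a ⊗ A)) v v) ⟩
    tr (A ⊗ (W a ⊗ A)) * κ
      ≡⟨ cong (_* κ) (tr-cong (⊗-congʳ A (≈-trans (⊗-congʳ (W a) (≈-sym W-1)) (W-+ a 1)))) ⟩
    h (suc (a + 1)) * κ
      ≡⟨ cong (λ t → h (suc t) * κ) (+-comm a 1) ⟩
    h (2 + a) * κ ∎
    where
    κ₀ = n ^ b * n ^ c
    κ = n * κ₀
    lem₁ : ∀ x y z → x * y * (1 * z) ≡ x * (y * z)
    lem₁ = solve-∀
    lem₂ : ∀ x y m z k → x * y * (m * (z * k)) ≡ x * (y * z) * (m * k)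
    lem₂ = solve-∀

  -- Under the trace, the piece before the first mark and the piece after the last one join
  -- cyclically into the third arc.
  trace-triple : ∀ v i₁ i₂ i₃ j →
    tr ((((δ ⊗ (W i₁ ⊗ D∙_ v A)) ⊗ (W i₂ ⊗ D∙_ v A)) ⊗ (W i₃ ⊗ D∙_ v A)) ⊗ W j)
      ≡ triple v (suc i₂) (suc i₃) (suc j + i₁)
  trace-triple v i₁ i₂ i₃ j = trans (tr-cong (≈-trans (pull ((δ ⊗ (W i₁ ⊗ X)) ⊗ (W i₂ ⊗ X)) i₃ (W j)) (≈-trans (pull (δ ⊗ (W i₁ ⊗ X)) i₂ (W i₃ ⊗ (X ⊗ W j)))
        (≈-trans (pull δ i₁ (W i₂ ⊗ (X ⊗ (W i₃ ⊗ (X ⊗ W j)))))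
        (≈-trans (δ-⊗ _) (⊗-congʳ (W i₁) (≈-trans (shift i₂ (X ⊗ (W i₃ ⊗ (X ⊗ W j)))) (⊗-congʳ B (shift i₃ (X ⊗ W j))))))))))
     (trans (tr-cyc (W i₁) (B ⊗ (C ⊗ (X ⊗ W j)))) (tr-cong (≈-trans (⊗-assoc B (C ⊗ (X ⊗ W j)) (W i₁))
        (⊗-congʳ B (≈-trans (⊗-assoc C (X ⊗ W j) (W i₁)) (⊗-congʳ C last))))))
    where
    X = D∙_ v A
    B = D∙_ v (W (suc i₂))
    C = D∙_ v (W (suc i₃))
    pull : ∀ K i S → (K ⊗ (W i ⊗ X)) ⊗ S ≈ K ⊗ (W i ⊗ (X ⊗ S))
    pull K i S = ≈-trans (⊗-assoc K (W i ⊗ X) S) (⊗-congʳ K (⊗-assoc (W i) X S))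
    shift : ∀ i S → X ⊗ (W i ⊗ S) ≈ D∙_ v (W (suc i)) ⊗ S
    shift i S = ≈-trans (≈-sym (⊗-assoc X (W i) S)) (⊗-cong {N = S} (D-⊗ v A (W i)) (λ _ _ → refl))
    last : (X ⊗ W j) ⊗ W i₁ ≈ D∙_ v (W (suc j + i₁))
    last = ≈-trans (⊗-cong {N = W i₁} (D-⊗ v A (W j)) (λ _ _ → refl))
      (≈-trans (D-⊗ v (W (suc j)) (W i₁)) (D-cong v (W-+ (suc j) i₁)))

  split : ∀ d β r L (K : Fin n → Mat n) →
    (∀ i j → i + suc j ≡ L → d * sumF (λ v → tr ((K v ⊗ (W i ⊗ D∙_ v A)) ⊗ mark v r j)) ≤ β) →
    d * sumF (λ v → tr (K v ⊗ mark v (suc r) L)) ≤ L * β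
  split d β r L K hyp = split-mark d β r L K λ i j eq → ≤-trans (≤-reflexive (cong (d *_) (sum-cong λ v → tr-cong
     (≈-sym (≈-trans (⊗-assoc (K v) (W i ⊗ D∙_ v A) (mark v r j)) (⊗-congʳ (K v)
       (≈-trans (⊗-assoc (W i) (D∙_ v A) (mark v r j)) (⊗-congʳ (W i) (D-⊗ v A (mark v r j))))))))))
     (hyp i j eq)

  mark₃-bound : ∀ d β L →
    (∀ a b c → suc a + (suc b + suc c) ≡ L → d * sumF (λ v → triple v (suc a) (suc b) (suc c)) ≤ β) →
    d * sumF (λ v → tr (mark v 3 L)) ≤ L * (L * (L * β))
  mark₃-bound d β L hyp = ≤-trans (≤-reflexive (cong (d *_) (sum-cong λ v → tr-cong (≈-sym (δ-⊗ (mark v 3 L))))))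
    (split d (L * (L * β)) 2 L (λ _ → δ) λ i₁ j₁ eq₁ → ≤-trans
      (split d (L * β) 1 j₁ (λ v → δ ⊗ (W i₁ ⊗ D∙_ v A)) λ i₂ j₂ eq₂ → ≤-trans
        (split d β 0 j₂ (λ v → (δ ⊗ (W i₁ ⊗ D∙_ v A)) ⊗ (W i₂ ⊗ D∙_ v A)) λ i₃ j₃ eq₃ → ≤-trans
          (≤-reflexive (cong (d *_) (sum-cong λ v → trace-triple v i₁ i₂ i₃ j₃)))
          (hyp i₂ i₃ (j₃ + i₁) (trans (lem i₁ i₂ i₃ j₃)
            (trans (cong (λ t → i₁ + suc (i₂ + suc t)) eq₃) (trans (cong (λ t → i₁ + suc t) eq₂) eq₁)))))
        (*-monoˡ-≤ β (≤-trans (sub eq₂) (sub eq₁))))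
      (*-monoˡ-≤ (L * β) (sub eq₁)))
    where
    sub : ∀ {i j m} → i + suc j ≡ m → j ≤ m
    sub {i} {j} refl = ≤-trans (n≤1+n j) (m≤n+m (suc j) i)
    lem : ∀ a b c d → suc b + (suc c + suc (d + a)) ≡ a + suc (b + suc (c + suc d))
    lem = solve-∀

  -- The degree condition reads deg ≥ (2 + 1/E) n/(2g+1). Since 2k+1 ≥ 2g+1, a closed walk of length
  -- 2k+1 has on average, over `v`, at least 2 + 1/E marks. By m ≤ 2 + C(m,3) the surplus 1/E must
  -- come from triples of marks (`excess`). There are at most L³ ways to place a triple, and each
  -- one contains a short odd arc, rotated to the front by `triple-cyc`.
  descent : .{{_ : NonZero n}} → ∀ g k E d → 2 ≤ g → g ≤ k → 1 ≤ E →
    (∀ z → suc (2 * E) * n ≤ E * suc (2 * g) * deg G z) →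
    (∀ s → s < k → E * (suc (2 * k) * (suc (2 * k) * suc (2 * k))) * d * h (suc (2 * s)) ≤ n ^ suc (2 * s)) →
    d * h (suc (2 * k)) ≤ n ^ suc (2 * k)
  descent g k E d 2≤g g≤k 1≤E degs hyp = *-cancelˡ-≤ (E * L³ * n) (begin
    E * L³ * n * (d * H)                ≡⟨ lem₁ (E * L³) n d H ⟩
    d′ * (n * H)                        ≤⟨ *-monoʳ-≤ d′ excess ⟩
    d′ * (E * sumF (λ v → tr (mark v 3 L)))  ≡⟨ lem₂ d′ E _ ⟩
    E * (d′ * sumF (λ v → tr (mark v 3 L)))  ≤⟨ *-monoʳ-≤ E (mark₃-bound d′ (n ^ suc L) L arcs) ⟩
    E * (L * (L * (L * (n * n ^ L))))   ≡⟨ lem₃ E L n (n ^ L) ⟩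
    E * L³ * n * n ^ L                  ∎)
    where
    L = suc (2 * k)
    L³ = L * (L * L)
    d′ = E * L³ * d
    H = h L
    instance
      E≢0 : NonZero E
      E≢0 = >-nonZero 1≤E
      EL≢0 : NonZero (E * L³)
      EL≢0 = m*n≢0 E L³
      ELn≢0 : NonZero (E * L³ * n)
      ELn≢0 = m*n≢0 (E * L³) n
    lem₁ : ∀ e n d h → e * n * (d * h) ≡ e * d * (n * h)
    lem₁ = solve-∀
    lem₂ : ∀ a b c → a * (b * c) ≡ b * (a * c)
    lem₂ = solve-∀
    lem₃ : ∀ e l n p → e * (l * (l * (l * (n * p)))) ≡ e * (l * (l * l)) * n * p
    lem₃ = solve-∀
    M₁ M₃ : ℕ
    M₁ = sumF (λ v → tr (mark v 1 L))
    M₃ = sumF (λ v → tr (mark v 3 L))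
    upper : M₁ ≤ 2 * n * H + M₃
    upper = begin
      M₁ ≤⟨ sum-mono (λ v → sum-mono λ x → mark₁≤₃ v L x x) ⟩
      sumF (λ v → tr (λ x y → 2 * W L x y + mark v 3 L x y))
        ≡⟨ sum-cong (λ v → trans (tr-+ (λ x y → 2 * W L x y) (mark v 3 L)) (cong (_+ tr (mark v 3 L)) (sum-*ˡ 2 (λ x → W L x x)))) ⟩
      sumF (λ v → 2 * H + tr (mark v 3 L)) ≡⟨ sum-+ (λ v → 2 * H) (λ v → tr (mark v 3 L)) ⟩
      sumF {n} (λ v → 2 * H) + M₃ ≡⟨ cong (_+ M₃) (trans (sum-const n (2 * H)) (lem₄ n H)) ⟩
      2 * n * H + M₃ ∎
      where lem₄ : ∀ n h → n * (2 * h) ≡ 2 * n * h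
            lem₄ = solve-∀
    P = suc (2 * E) * n
    lower : P * H ≤ E * M₁
    lower = *-cancelˡ-≤ (suc (2 * g)) (begin
      suc (2 * g) * (P * H)     ≡⟨ *-assoc (suc (2 * g)) P H ⟨
      suc (2 * g) * P * H       ≤⟨ *-monoˡ-≤ H (*-monoˡ-≤ P (s≤s (*-monoʳ-≤ 2 g≤k))) ⟩
      L * P * H                 ≡⟨ sum-*ˡ (L * P) (λ x → W L x x) ⟨
      sumF (λ x → L * P * W L x x) ≤⟨ sum-mono (λ x → mark₁-lower P (E * suc (2 * g)) degs L x x) ⟩
      sumF (λ x → E * suc (2 * g) * sumF (λ v → mark v 1 L x x)) ≡⟨ sum-*ˡ (E * suc (2 * g)) (λ x → sumF (λ v → mark v 1 L x x)) ⟩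
      E * suc (2 * g) * sumF (λ x → sumF (λ v → mark v 1 L x x))
        ≡⟨ cong (E * suc (2 * g) *_) (sum-swap (λ x v → mark v 1 L x x)) ⟩
      E * suc (2 * g) * M₁ ≡⟨ lem₅ E (suc (2 * g)) M₁ ⟩
      suc (2 * g) * (E * M₁) ∎)
      where lem₅ : ∀ a b c → a * b * c ≡ b * (a * c)
            lem₅ = solve-∀
    excess : n * H ≤ E * M₃
    excess = +-cancelˡ-≤ (2 * E * (n * H)) _ _ (begin
      2 * E * (n * H) + n * H       ≡⟨ lem₆ E n H ⟩
      P * H                         ≤⟨ lower ⟩
      E * M₁                        ≤⟨ *-monoʳ-≤ E upper ⟩
      E * (2 * n * H + M₃)          ≡⟨ lem₇ E n H M₃ ⟩
      2 * E * (n * H) + E * M₃      ∎)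
      where
      lem₆ : ∀ e n h → 2 * e * (n * h) + n * h ≡ suc (2 * e) * n * h
      lem₆ = solve-∀
      lem₇ : ∀ e n h m → e * (2 * n * h + m) ≡ 2 * e * (n * h) + e * m
      lem₇ = solve-∀
    first-arc : ∀ a b c → suc a + (suc b + suc c) ≡ L → ShortOdd k (suc a) →
      d′ * sumF (λ v → triple v (suc a) (suc b) (suc c)) ≤ n ^ suc L
    first-arc a b c eq (s , refl , s<k) = begin
      d′ * sumF (λ v → triple v (suc a) (suc b) (suc c)) ≤⟨ *-monoʳ-≤ d′ (triple-bound (suc a) b c) ⟩
      d′ * (h (2 + suc a) * κ)        ≡⟨ *-assoc d′ _ _ ⟨
      d′ * h (2 + suc a) * κ          ≡⟨ cong (λ t → d′ * h t * κ) (lem₈ s) ⟩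
      d′ * h (suc (2 * suc s)) * κ    ≤⟨ *-monoˡ-≤ κ (hyp (suc s) s<k) ⟩
      n ^ suc (2 * suc s) * κ         ≡⟨ cong (n ^ suc (2 * suc s) *_) (cong (n *_) (^-distribˡ-+-* n b c)) ⟨
      n ^ suc (2 * suc s) * n ^ suc (b + c) ≡⟨ ^-distribˡ-+-* n (suc (2 * suc s)) (suc (b + c)) ⟨
      n ^ (suc (2 * suc s) + suc (b + c))   ≡⟨ cong (n ^_) (trans (lem₉ s b c) (cong suc eq)) ⟩
      n ^ suc L ∎
      where
      κ = n * (n ^ b * n ^ c)
      lem₈ : ∀ s → 2 + suc (2 * s) ≡ suc (2 * suc s)
      lem₈ = solve-∀
      lem₉ : ∀ s b c → suc (2 * suc s) + suc (b + c) ≡ suc (suc (2 * s) + (suc b + suc c))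
      lem₉ = solve-∀
    arcs : ∀ a b c → suc a + (suc b + suc c) ≡ L → d′ * sumF (λ v → triple v (suc a) (suc b) (suc c)) ≤ n ^ suc L
    arcs a b c eq with short-odd-arc k (suc a) (suc b) (suc c) (≤-trans 2≤g g≤k) (s≤s z≤n) (s≤s z≤n) (s≤s z≤n) eq
    ... | inj₁ o        = first-arc a b c eq o
    ... | inj₂ (inj₁ o) = ≤-trans (≤-reflexive (cong (d′ *_) (sum-cong λ v → triple-cyc v (suc a) (suc b) (suc c))))
      (first-arc b c a (trans (rot (suc a) (suc b) (suc c)) eq) o)
      where rot : ∀ a b c → b + (c + a) ≡ a + (b + c)
            rot = solve-∀
    ... | inj₂ (inj₂ o) = ≤-trans (≤-reflexive (cong (d′ *_) (sum-cong λ v → sym (triple-cyc v (suc c) (suc a) (suc b)))))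
      (first-arc c a b (trans (rot (suc a) (suc b) (suc c)) eq) o)
      where rot : ∀ a b c → c + (a + b) ≡ a + (b + c)
            rot = solve-∀

  -- `d` is quantified after `k` because the induction changes it: a bound with `d` at one length
  -- requires bounds with a larger constant at all shorter odd lengths.
  few-odd-walks : .{{_ : NonZero n}} → ∀ g E → 2 ≤ g → 1 ≤ E →
    (∀ z → suc (2 * E) * n ≤ E * suc (2 * g) * deg G z) → ∀ k d →
    (∀ s → s < g → amplify E k d * h (suc (2 * s)) ≤ n ^ suc (2 * s)) →
    ∀ s → s < k → d * h (suc (2 * s)) ≤ n ^ suc (2 * s)
  few-odd-walks g E 2≤g 1≤E degs (suc k) d hyp s s<1+k with m≤n⇒m<n∨m≡n (s≤s⁻¹ s<1+k)
  ... | inj₁ s<k = ≤-trans (*-monoˡ-≤ (h (suc (2 * s))) (d≤scaled E k d 1≤E)) (few-odd-walks g E 2≤g 1≤E degs k _ hyp s s<k)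
  ... | inj₂ refl with s <? g
  ...   | yes s<g = ≤-trans (*-monoˡ-≤ (h (suc (2 * s))) (d≤amplify E (suc s) d 1≤E)) (hyp s s<g)
  ...   | no s≮g  = descent g s E d 2≤g (≮⇒≥ s≮g) 1≤E degs (few-odd-walks g E 2≤g 1≤E degs s _ hyp)

-- Blow-ups in dense sets of closed walks

sumV : ∀ {n} m → (Vec (Fin n) m → ℕ) → ℕ
sumV zero    f = f []
sumV (suc m) f = sumF λ x → sumV m λ c → f (x ∷ c)

sumV-cong : ∀ {n} m {f g : Vec (Fin n) m → ℕ} → (∀ c → f c ≡ g c) → sumV m f ≡ sumV m g
sumV-cong zero    p = p []
sumV-cong (suc m) p = sum-cong λ x → sumV-cong m λ c → p (x ∷ c)

sumV-+ : ∀ {n} m (f g : Vec (Fin n) m → ℕ) → sumV m (λ c → f c + g c) ≡ sumV m f + sumV m g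
sumV-+ zero    f g = refl
sumV-+ (suc m) f g = trans (sum-cong λ x → sumV-+ m (λ c → f (x ∷ c)) (λ c → g (x ∷ c)))
  (sum-+ (λ x → sumV m λ c → f (x ∷ c)) (λ x → sumV m λ c → g (x ∷ c)))

sumV-*ˡ : ∀ {n} m k (f : Vec (Fin n) m → ℕ) → sumV m (λ c → k * f c) ≡ k * sumV m f
sumV-*ˡ zero    k f = refl
sumV-*ˡ (suc m) k f = trans (sum-cong λ x → sumV-*ˡ m k (λ c → f (x ∷ c))) (sum-*ˡ k (λ x → sumV m λ c → f (x ∷ c)))

sumV-const : ∀ {n} m k → sumV {n} m (λ _ → k) ≡ n ^ m * k
sumV-const zero    k = sym (+-identityʳ k)
sumV-const {n} (suc m) k = trans (sum-cong {n} λ x → sumV-const m k) (trans (sum-const n (n ^ m * k)) (sym (*-assoc n (n ^ m) k)))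

sumV-swap : ∀ {n k} m (f : Fin k → Vec (Fin n) m → ℕ) →
  sumF (λ x → sumV m (f x)) ≡ sumV m (λ c → sumF (λ x → f x c))
sumV-swap zero    f = refl
sumV-swap (suc m) f = trans (sum-swap (λ x y → sumV m λ c → f x (y ∷ c)))
  (sum-cong λ y → sumV-swap m (λ x c → f x (y ∷ c)))

sumV-< : ∀ {n} m (f g : Vec (Fin n) m → ℕ) → sumV m f < sumV m g → ∃ λ c → f c < g c
sumV-< zero    f g lt = [] , lt
sumV-< (suc m) f g lt with sum-< (λ x → sumV m λ c → f (x ∷ c)) (λ x → sumV m λ c → g (x ∷ c)) lt
... | x , lt′ with sumV-< m (λ c → f (x ∷ c)) (λ c → g (x ∷ c)) lt′
...   | c , p = x ∷ c , p

cauchy-schwarzV : ∀ {n} m (f : Vec (Fin n) m → ℕ) → sumV m f * sumV m f ≤ n ^ m * sumV m (λ c → f c * f c)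
cauchy-schwarzV zero    f = ≤-reflexive (sym (+-identityʳ _))
cauchy-schwarzV {n} (suc m) f = begin
  sumF S * sumF S                                ≤⟨ cauchy-schwarz S ⟩
  n * sumF (λ x → S x * S x)                     ≤⟨ *-monoʳ-≤ n (sum-mono λ x → cauchy-schwarzV m (λ c → f (x ∷ c))) ⟩
  n * sumF (λ x → n ^ m * Q x)                   ≡⟨ cong (n *_) (sum-*ˡ (n ^ m) Q) ⟩
  n * (n ^ m * sumF Q)                           ≡⟨ *-assoc n (n ^ m) _ ⟨
  n ^ suc m * sumF Q                             ∎
  where
  S Q : Fin n → ℕ
  S x = sumV m λ c → f (x ∷ c)
  Q x = sumV m λ c → f (x ∷ c) * f (x ∷ c)

-- Group the tuples by all coordinates except the `i`-th and apply Cauchy-Schwarz over the n^m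
-- groups. The square of the sum in one group runs over pairs of values of that coordinate, the
-- original and its clone.
clone-count : ∀ {n} m (i : Fin (suc m)) (f : Vec (Fin n) (suc m) → ℕ) →
  sumV (suc m) f * sumV (suc m) f ≤ n ^ m * sumF (λ y → sumV (suc m) λ c → f c * f (c [ i ]≔ y))
clone-count {n} m zero f = begin
  sumV (suc m) f * sumV (suc m) f  ≡⟨ cong₂ _*_ eq eq ⟩
  sumV m F * sumV m F              ≤⟨ cauchy-schwarzV m F ⟩
  n ^ m * sumV m (λ c → F c * F c)
    ≡⟨ cong (n ^ m *_) (trans (sumV-cong m λ c → trans (sum-*-sum (λ y → f (y ∷ c)) (λ x → f (x ∷ c)))
                                 (sum-cong λ y → sum-cong λ x → *-comm (f (y ∷ c)) (f (x ∷ c))))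
                         (trans (sym (sumV-swap m (λ y c → sumF (λ x → f (x ∷ c) * f (y ∷ c)))))
                                (sum-cong λ y → sym (sumV-swap m (λ x c → f (x ∷ c) * f (y ∷ c)))))) ⟩
  n ^ m * sumF (λ y → sumF (λ x → sumV m λ c → f (x ∷ c) * f (y ∷ c))) ∎
  where
  F : Vec (Fin n) m → ℕ
  F c = sumF λ x → f (x ∷ c)
  eq : sumV (suc m) f ≡ sumV m F
  eq = sumV-swap m (λ x c → f (x ∷ c))
clone-count {n} (suc m) (suc i) f = begin
  sumF S * sumF S                  ≤⟨ cauchy-schwarz S ⟩
  n * sumF (λ x → S x * S x)       ≤⟨ *-monoʳ-≤ n (sum-mono λ x → clone-count m i (λ c → f (x ∷ c))) ⟩
  n * sumF (λ x → n ^ m * sumF (Q x))  ≡⟨ cong (n *_) (sum-*ˡ (n ^ m) (λ x → sumF (Q x))) ⟩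
  n * (n ^ m * sumF (λ x → sumF (Q x))) ≡⟨ *-assoc n (n ^ m) _ ⟨
  n ^ suc m * sumF (λ x → sumF (Q x)) ≡⟨ cong (n ^ suc m *_) (sum-swap Q) ⟩
  n ^ suc m * sumF (λ y → sumF (λ x → Q x y)) ∎
  where
  S : Fin n → ℕ
  S x = sumV (suc m) λ c → f (x ∷ c)
  Q : Fin n → Fin n → ℕ
  Q x y = sumV (suc m) λ c → f (x ∷ c) * f (x ∷ (c [ i ]≔ y))

-- Coincidences among the entries of a tuple.

occ : ∀ {n m} → Fin n → Vec (Fin n) m → ℕ
occ x []      = 0
occ x (y ∷ c) = δ y x + occ x c

collisions : ∀ {n m} → Vec (Fin n) m → ℕ
collisions []      = 0
collisions (x ∷ c) = occ x c + collisions c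

occ>0 : ∀ {n m} (x : Fin n) (c : Vec (Fin n) m) i → lookup c i ≡ x → 1 ≤ occ x c
occ>0 x (y ∷ c) zero    refl = ≤-trans (≤-reflexive (sym (δ-refl y))) (m≤m+n _ _)
occ>0 x (y ∷ c) (suc i) eq   = ≤-trans (occ>0 x c i eq) (m≤n+m _ _)

collision-free : ∀ {n m} (c : Vec (Fin n) m) → collisions c ≡ 0 → ∀ i j → lookup c i ≡ lookup c j → i ≡ j
collision-free (x ∷ c) p zero    zero    eq = refl
collision-free (x ∷ c) p zero    (suc j) eq = ⊥-elim (<⇒≢ (≤-trans (occ>0 x c j (sym eq)) (m≤m+n _ _)) (sym p))
collision-free (x ∷ c) p (suc i) zero    eq = ⊥-elim (<⇒≢ (≤-trans (occ>0 x c i eq) (m≤m+n _ _)) (sym p))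
collision-free (x ∷ c) p (suc i) (suc j) eq = cong suc (collision-free c (m+n≡0⇒n≡0 (occ x c) p) i j eq)

sum-occ : ∀ {n m} (c : Vec (Fin n) m) → sumF (λ x → occ x c) ≡ m
sum-occ {n} []      = sum-0 n
sum-occ (y ∷ c) = trans (sum-+ (δ y) (λ x → occ x c))
  (cong₂ _+_ (sum-δ y) (sum-occ c))

-- A fixed pair of positions agrees in a 1/n fraction of all tuples, and there are fewer than m²
-- pairs when m is positive.
collisions-bound : ∀ n m → n * sumV {n} m collisions ≤ m * m * n ^ m
collisions-bound n zero    = ≤-reflexive (*-zeroʳ n)
collisions-bound n (suc m) = begin
  n * sumF {n} (λ x → sumV m (λ c → occ x c + collisions c))
    ≡⟨ cong (n *_) (trans (sum-cong {n} λ x → sumV-+ m (occ x) collisions) (sum-+ {n} (λ x → sumV m (occ x)) (λ _ → C))) ⟩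
  n * (sumF {n} (λ x → sumV m (occ x)) + sumF {n} (λ _ → C))
    ≡⟨ cong (n *_) (cong₂ _+_ (trans (sumV-swap {n} m occ) (trans (sumV-cong m sum-occ) (sumV-const m m))) (sum-const n C)) ⟩
  n * (n ^ m * m + n * C)               ≤⟨ *-monoʳ-≤ n (+-monoʳ-≤ (n ^ m * m) (collisions-bound n m)) ⟩
  n * (n ^ m * m + m * m * n ^ m)       ≤⟨ m≤m+n _ (n * n ^ m * suc m) ⟩
  n * (n ^ m * m + m * m * n ^ m) + n * n ^ m * suc m  ≡⟨ lem n m (n ^ m) ⟩
  suc m * suc m * (n * n ^ m)           ∎
  where
  C = sumV {n} m collisions
  lem : ∀ n m p → n * (p * m + m * m * p) + n * p * suc m ≡ suc m * suc m * (n * p)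
  lem = solve-∀

factors : ∀ a b → 1 ≤ a * b → 1 ≤ a × 1 ≤ b
factors (suc a) zero p = ⊥-elim (<⇒≱ p (≤-reflexive (*-zeroʳ a)))
factors (suc a) (suc b) p = s≤s z≤n , s≤s z≤n

-- This is D^(2^k): each cloning squares the inverse density.
towerSquare : ℕ → ℕ → ℕ
towerSquare zero    D = D
towerSquare (suc k) D = towerSquare k D * towerSquare k D

module Cloning {n L : ℕ} .{{_ : NonZero n}} (G : Graph n) (R : Fin L → Fin L → Bool) (R-irr : ∀ i → R i i ≡ false) where

  -- f is the indicator of a set of homomorphisms into G from the blow-up of R that has
  -- m vertices, the i-th of which is a copy of the vertex lookup ψ i of R.
  record Dense (D : ℕ) {m : ℕ} (ψ : Vec (Fin L) m) : Set where
    field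
      f     : Vec (Fin n) m → ℕ
      f≤1   : ∀ c → f c ≤ 1
      hom   : ∀ c → 1 ≤ f c → ∀ i j → R (lookup ψ i) (lookup ψ j) ≡ true → adj G (lookup c i) (lookup c j) ≡ true
      dense : n ^ m ≤ D * sumV m f

  -- Both the tuple and the tuple with `y` in place of its `i`-th entry must be homomorphisms. Edges
  -- at the clone are read off the second one; irreflexivity of `R` ensures that the other end of
  -- such an edge is not position `i`, so the replacement leaves it alone, and that no edge between
  -- original and clone is required.
  clone : ∀ {D m} {ψ : Vec (Fin L) m} → Dense D ψ → (i : Fin m) → Dense (D * D) (lookup ψ i ∷ ψ)
  clone {D} {suc m} {ψ} F i = record { f = f′ ; f≤1 = f′≤1 ; hom = hom′ ; dense = dense′ }
    where
    open Dense F
    f′ : Vec (Fin n) (suc (suc m)) → ℕ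
    f′ (y ∷ c) = f c * f (c [ i ]≔ y)
    f′≤1 : ∀ c → f′ c ≤ 1
    f′≤1 (y ∷ c) = *-mono-≤ (f≤1 c) (f≤1 (c [ i ]≔ y))
    irr⇒≢ : ∀ {j j′} → R (lookup ψ j) (lookup ψ j′) ≡ true → j ≢ j′
    irr⇒≢ {j} r refl with trans (sym r) (R-irr (lookup ψ j))
    ... | ()
    hom′ : ∀ c → 1 ≤ f′ c → ∀ a b → R (lookup (lookup ψ i ∷ ψ) a) (lookup (lookup ψ i ∷ ψ) b) ≡ true →
      adj G (lookup c a) (lookup c b) ≡ true
    hom′ (y ∷ c) p zero zero r = ⊥-elim (irr⇒≢ r refl)
    hom′ (y ∷ c) p zero (suc b) r =
      subst₂ (λ s t → adj G s t ≡ true) (lookup∘update i c y) (lookup∘update′ (irr⇒≢ r ∘ sym) c y)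
        (hom (c [ i ]≔ y) (proj₂ (factors (f c) _ p)) i b r)
    hom′ (y ∷ c) p (suc a) zero r =
      subst₂ (λ s t → adj G s t ≡ true) (lookup∘update′ (irr⇒≢ r) c y) (lookup∘update i c y)
        (hom (c [ i ]≔ y) (proj₂ (factors (f c) _ p)) a i r)
    hom′ (y ∷ c) p (suc a) (suc b) r = hom c (proj₁ (factors (f c) _ p)) a b r
    S S′ : ℕ
    S = sumV (suc m) f
    S′ = sumV (suc (suc m)) f′
    instance
      n^m≢0 : NonZero (n ^ m)
      n^m≢0 = m^n≢0 n m
    dense′ : n ^ suc (suc m) ≤ D * D * S′
    dense′ = *-cancelˡ-≤ (n ^ m) (begin
      n ^ m * (n * (n * n ^ m))     ≡⟨ lem₁ (n ^ m) n ⟩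
      n ^ suc m * n ^ suc m         ≤⟨ *-mono-≤ dense dense ⟩
      D * S * (D * S)               ≡⟨ lem₂ D S ⟩
      D * D * (S * S)               ≤⟨ *-monoʳ-≤ (D * D) (clone-count m i f) ⟩
      D * D * (n ^ m * S′)          ≡⟨ lem₃ (D * D) (n ^ m) S′ ⟩
      n ^ m * (D * D * S′) ∎)
      where
      lem₁ : ∀ p n → p * (n * (n * p)) ≡ n * p * (n * p)
      lem₁ = solve-∀
      lem₂ : ∀ d s → d * s * (d * s) ≡ d * d * (s * s)
      lem₂ = solve-∀
      lem₃ : ∀ d p s → d * (p * s) ≡ p * (d * s)
      lem₃ = solve-∀

  -- Starts from one copy of each vertex of `R` and prepends a copy of each entry of `φ`. Always
  -- cloning from the original block at the end keeps the index explicit.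
  clones : ∀ {D k} (φ : Vec (Fin L) k) → Dense D (allFin L) → Dense (towerSquare k D) (φ ++ allFin L)
  clones [] F = F
  clones {D} {suc k} (t ∷ φ) F = subst (λ s → Dense (towerSquare k D * towerSquare k D) (s ∷ (φ ++ allFin L)))
    (trans (lookup-++ʳ φ (allFin L) t) (lookup-allFin t)) (clone (clones φ F) (k ↑ʳ t))

  -- The homomorphic tuples have positive density, whereas coincidences have density O(1/n). For
  -- large n some homomorphic tuple is therefore injective, and its first `k` entries carry `H`.
  embed : ∀ {D k} (H : Graph k) → Hom H R → Dense D (allFin L) → towerSquare k D * ((k + L) * (k + L)) < n → Contains H G
  embed {D} {k} H (φ , φ-hom) F big with sumV-< (k + L) collisions f few
    where
    Φ = tabulate φ
    open Dense (clones Φ F)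
    instance
      n^m≢0 : NonZero (n ^ (k + L))
      n^m≢0 = m^n≢0 n (k + L)
    few : sumV (k + L) collisions < sumV (k + L) f
    few = ≰⇒> λ q → <⇒≱ big (*-cancelʳ-≤ n _ (n ^ (k + L)) (begin
      n * n ^ (k + L)                             ≤⟨ *-monoʳ-≤ n dense ⟩
      n * (towerSquare k D * sumV (k + L) f)               ≤⟨ *-monoʳ-≤ n (*-monoʳ-≤ (towerSquare k D) q) ⟩
      n * (towerSquare k D * sumV {n} (k + L) collisions)  ≡⟨ lem n (towerSquare k D) _ ⟩
      towerSquare k D * (n * sumV {n} (k + L) collisions)  ≤⟨ *-monoʳ-≤ (towerSquare k D) (collisions-bound n (k + L)) ⟩
      towerSquare k D * ((k + L) * (k + L) * n ^ (k + L))  ≡⟨ *-assoc (towerSquare k D) _ _ ⟨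
      towerSquare k D * ((k + L) * (k + L)) * n ^ (k + L)  ∎))
      where lem : ∀ a b c → a * (b * c) ≡ b * (a * c)
            lem = solve-∀
  ... | c , c< = (λ u → lookup c (u ↑ˡ L)) , inj , adjacent
    where
    Φ = tabulate φ
    open Dense (clones Φ F)
    free : collisions c ≡ 0
    -- `f` is 0 or 1, so strictly fewer collisions than `f c` means none.
    free = n≤0⇒n≡0 (s≤s⁻¹ (≤-trans c< (f≤1 c)))
    inj : ∀ {u v} → lookup c (u ↑ˡ L) ≡ lookup c (v ↑ˡ L) → u ≡ v
    inj {u} {v} eq = Fin.↑ˡ-injective L u v (collision-free c free (u ↑ˡ L) (v ↑ˡ L) eq)
    image : ∀ u → lookup (Φ ++ allFin L) (u ↑ˡ L) ≡ φ u
    image u = trans (lookup-++ˡ Φ (allFin L) u) (lookup∘tabulate φ u)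
    adjacent : ∀ u v → adj H u v ≡ true → adj G (lookup c (u ↑ˡ L)) (lookup c (v ↑ˡ L)) ≡ true
    adjacent u v e = hom c (≤-trans (s≤s z≤n) c<) (u ↑ˡ L) (v ↑ˡ L)
      (trans (cong₂ R (image u) (image v)) (φ-hom u v e))

-- Cyclic adjacency and closed walks as copies of a cycle.

Cyc-step : ∀ m (i j : Fin (suc m)) → Cyc m i j ≡ true →
  suc (toℕ i) % suc m ≡ toℕ j ⊎ suc (toℕ j) % suc m ≡ toℕ i
Cyc-step m i j e with Function.Equivalence.to T-∨ (Function.Equivalence.from T-≡ e)
... | inj₁ p = inj₁ (≡ᵇ⇒≡ _ _ p)
... | inj₂ p = inj₂ (≡ᵇ⇒≡ _ _ p)

Cyc-next : ∀ m i j → suc (toℕ i) % suc m ≡ toℕ j → Cyc m i j ≡ true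
Cyc-next m i j e = cong (_∨ (suc (toℕ j) % suc m ≡ᵇ toℕ i)) (Function.Equivalence.to T-≡ (≡⇒≡ᵇ _ _ e))

next-cases : ∀ m (i j : Fin (suc m)) → suc (toℕ i) % suc m ≡ toℕ j → toℕ j ≡ suc (toℕ i) ⊎ (toℕ i ≡ m × j ≡ zero)
next-cases m i j e with m≤n⇒m<n∨m≡n (s≤s⁻¹ (Fin.toℕ<n i))
... | inj₁ i<m = inj₁ (trans (sym e) (m<n⇒m%n≡m (s≤s i<m)))
... | inj₂ i≡m = inj₂ (i≡m , Fin.toℕ-injective (trans (sym e) (trans (cong (λ t → suc t % suc m) i≡m) (n%n≡0 (suc m)))))

Cyc-irr : ∀ m → 1 ≤ m → ∀ i → Cyc m i i ≡ false
Cyc-irr m 1≤m i with Cyc m i i in eq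
... | false = refl
... | true = ⊥-elim (bad (reduce (Cyc-step m i i eq)))
  where
  bad : suc (toℕ i) % suc m ≢ toℕ i
  bad p with next-cases m i i p
  ... | inj₁ q = 1+n≢n (sym q)
  ... | inj₂ (q , refl) = <⇒≢ 1≤m q

module ClosedWalks {n : ℕ} .{{_ : NonZero n}} (G : Graph n) where
  open Walks G

  path : ∀ {m} → Fin n → Vec (Fin n) m → Fin n → ℕ
  path x []      y = A x y
  path x (z ∷ c) y = A x z * path z c y

  path≤1 : ∀ {m} x (c : Vec (Fin n) m) y → path x c y ≤ 1
  path≤1 x []      y = A≤1 x y
  path≤1 x (z ∷ c) y = *-mono-≤ (A≤1 x z) (path≤1 z c y)

  W-path : ∀ m x y → W (suc m) x y ≡ sumV m (λ c → path x c y)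
  W-path zero    x y = W-1 x y
  W-path (suc m) x y = sum-cong λ z → trans (cong (A x z *_) (W-path m z y)) (sym (sumV-*ˡ m (A x z) (λ c → path z c y)))

  A>0 : ∀ x y → 1 ≤ A x y → adj G x y ≡ true
  A>0 x y p with adj G x y
  ... | true = refl

  path-step : ∀ {m} x (c : Vec (Fin n) m) y → 1 ≤ path x c y → ∀ i j → toℕ j ≡ suc (toℕ i) →
    adj G (lookup (x ∷ c) i) (lookup (x ∷ c) j) ≡ true
  path-step x (z ∷ c) y p zero    (suc zero) e = A>0 x z (proj₁ (factors (A x z) _ p))
  path-step x (z ∷ c) y p (suc i) (suc j)    e = path-step z c y (proj₂ (factors (A x z) _ p)) i j (suc-injective e)

  path-last : ∀ {m} x (c : Vec (Fin n) m) y → 1 ≤ path x c y → ∀ i → toℕ i ≡ m → adj G (lookup (x ∷ c) i) y ≡ true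
  path-last x []      y p zero    e = A>0 x y p
  path-last x (z ∷ c) y p (suc i) e = path-last z c y (proj₂ (factors (A x z) _ p)) i (suc-injective e)

  closed-walk-cyclic : ∀ {m} x (c : Vec (Fin n) m) → 1 ≤ path x c x → ∀ i j → Cyc m i j ≡ true →
    adj G (lookup (x ∷ c) i) (lookup (x ∷ c) j) ≡ true
  closed-walk-cyclic {m} x c p i j e =
    [ forward i j , trans (Graph.sym G _ _) ∘ forward j i ] (Cyc-step m i j e)
    where
    forward : ∀ i j → suc (toℕ i) % suc m ≡ toℕ j → adj G (lookup (x ∷ c) i) (lookup (x ∷ c) j) ≡ true
    forward i j q with next-cases m i j q
    ... | inj₁ r = path-step x c x p i j r
    ... | inj₂ (r , refl) = path-last x c x p i r

  module _ (m : ℕ) (1≤m : 1 ≤ m) where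
    open Cloning G (Cyc m) (Cyc-irr m 1≤m)

    closed-walks-dense : ∀ D → n ^ suc m ≤ D * h (suc m) → Dense D (allFin (suc m))
    closed-walks-dense D p = record
      { f = λ { (x ∷ c) → path x c x }
      ; f≤1 = λ { (x ∷ c) → path≤1 x c x }
      ; hom = λ { (x ∷ c) q i j r → closed-walk-cyclic x c q i j
                    (trans (sym (cong₂ (Cyc m) (lookup-allFin i) (lookup-allFin j))) r) }
      ; dense = ≤-trans p (≤-reflexive (cong (D *_) (sum-cong λ x → W-path m x x)))
      }

    free⇒few-closed-walks : ∀ {k} (H : Graph k) → Hom H (Cyc m) → Free H G → ∀ D →
      towerSquare k D * ((k + suc m) * (k + suc m)) < n → D * h (suc m) ≤ n ^ suc m
    free⇒few-closed-walks H φ free D big = ≮⇒≥ λ q → free (embed H φ (closed-walks-dense D (<⇒≤ q)) big)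

-- Lazy walks and robustly reachable sets

does⇒ : ∀ {P : Set} (d : Dec P) → does d ≡ true → P
does⇒ (yes p) _ = p

¬does⇒ : ∀ {P : Set} (d : Dec P) → does d ≡ false → ¬ P
¬does⇒ (no ¬p) _ = ¬p

oddᵇ : ℕ → Bool
oddᵇ zero    = false
oddᵇ (suc m) = not (oddᵇ m)

same : Bool → Bool → Bool
same a b = not (a xor b)

same⇒≡ : ∀ a b → same a b ≡ true → a ≡ b
same⇒≡ true  true  _ = refl
same⇒≡ false false _ = refl

⟦⟧-elim : ∀ k b {m} → (b ≡ true → k ≤ m) → k * ⟦ b ⟧ ≤ m
⟦⟧-elim k true  p = ≤-trans (≤-reflexive (*-identityʳ k)) (p refl)
⟦⟧-elim k false p = ≤-trans (≤-reflexive (*-zeroʳ k)) z≤n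

double : ∀ a → a + a ≡ 2 * a
double = solve-∀

module Lazy {n : ℕ} (G : Graph n) where
  open Walks G
  open Descent G using (≈-trans; ≈-sym)

  -- Walks from x to u that may also rest, each rest contributing a factor n; σ is the
  -- parity of the number of proper steps.
  X : ℕ → Bool → Mat n
  X zero    false     = δ
  X zero    true  _ _ = 0
  X (suc j) σ     u x = n * X j σ u x + (A ⊗ X j (not σ)) u x

  Y : ℕ → Mat n
  Y j u x = X j false u x + X j true u x

  Y-suc : ∀ j u x → Y (suc j) u x ≡ n * Y j u x + (A ⊗ Y j) u x
  Y-suc j u x = trans (lem n (X j false u x) (X j true u x) ((A ⊗ X j true) u x) ((A ⊗ X j false) u x))
    (cong (n * Y j u x +_) (sym (⊗-distribˡ A (X j false) (X j true) u x)))
    where lem : ∀ n a b c d → (n * a + c) + (n * b + d) ≡ n * (a + b) + (d + c)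
          lem = solve-∀

  -- The form tr(MᵀN). As `A` is symmetric, steps can be moved from one argument to the other, which
  -- turns two walks from `x` with a link between their ends into a closed walk.
  ⟪_,_⟫ : Mat n → Mat n → ℕ
  ⟪ M , N ⟫ = sumF λ x → sumF λ u → M u x * N u x

  ⟪⟫-congʳ : ∀ M {N N′} → N ≈ N′ → ⟪ M , N ⟫ ≡ ⟪ M , N′ ⟫
  ⟪⟫-congʳ M p = sum-cong λ x → sum-cong λ u → cong (M u x *_) (p u x)

  ⟪⟫-linear : ∀ k M M′ N → ⟪ (λ u x → k * M u x + M′ u x) , N ⟫ ≡ k * ⟪ M , N ⟫ + ⟪ M′ , N ⟫
  ⟪⟫-linear k M M′ N = trans (sum-cong λ x → trans (sum-cong λ u → lem k (M u x) (M′ u x) (N u x))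
      (trans (sum-+ (λ u → k * (M u x * N u x)) (λ u → M′ u x * N u x))
        (cong (_+ sumF (λ u → M′ u x * N u x)) (sum-*ˡ k (λ u → M u x * N u x)))))
    (trans (sum-+ (λ x → k * sumF (λ u → M u x * N u x)) (λ x → sumF λ u → M′ u x * N u x))
      (cong (_+ ⟪ M′ , N ⟫) (sum-*ˡ k (λ x → sumF λ u → M u x * N u x))))
    where lem : ∀ k a b c → (k * a + b) * c ≡ k * (a * c) + b * c
          lem = solve-∀

  ⟪⟫-adjoint : ∀ M N → ⟪ A ⊗ M , N ⟫ ≡ ⟪ M , A ⊗ N ⟫
  ⟪⟫-adjoint M N = sum-cong λ x → begin-equality
    sumF (λ u → sumF (λ z → A u z * M z x) * N u x)
      ≡⟨ sum-cong (λ u → sum-*ʳ (N u x) (λ z → A u z * M z x)) ⟨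
    sumF (λ u → sumF (λ z → A u z * M z x * N u x))
      ≡⟨ sum-swap (λ u z → A u z * M z x * N u x) ⟩
    sumF (λ z → sumF (λ u → A u z * M z x * N u x))
      ≡⟨ sum-cong (λ z → trans (sum-cong λ u → trans (cong (λ t → t * M z x * N u x) (A-sym u z)) (lem (A z u) (M z x) (N u x)))
           (sum-*ˡ (M z x) (λ u → A z u * N u x))) ⟩
    sumF (λ z → M z x * sumF (λ u → A z u * N u x)) ∎
    where lem : ∀ a b c → a * b * c ≡ b * (a * c)
          lem = solve-∀

  ⟪δ,⟫ : ∀ N → ⟪ δ , N ⟫ ≡ tr N
  ⟪δ,⟫ N = sum-cong λ x → trans (sum-cong λ u → cong (_* N u x) (δ-sym u x)) (sum-δˡ x (λ u → N u x))

  ⟪0,⟫ : ∀ N → ⟪ (λ _ _ → 0) , N ⟫ ≡ 0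
  ⟪0,⟫ N = trans (sum-cong {n} λ x → sum-0 n) (sum-0 n)

  A⊗W : ∀ p M → A ⊗ (W p ⊗ M) ≈ W (suc p) ⊗ M
  A⊗W p M = ≈-sym (⊗-assoc A (W p) M)

  W⊗A : ∀ p M → W p ⊗ (A ⊗ M) ≈ W (suc p) ⊗ M
  W⊗A p M = ≈-trans (≈-sym (⊗-assoc (W p) A M)) (⊗-cong {N = M} (≈-trans (⊗-congʳ (W p) (≈-sym W-1))
    (≈-trans (W-+ p 1) (λ x y → cong (λ t → W t x y) (+-comm p 1)))) (λ _ _ → refl))

  module _ (D Lmax : ℕ) (few : ∀ L → L ≤ Lmax → oddᵇ L ≡ true → D * h L ≤ n ^ L) where

    private
      flip-parity : ∀ a b c → (a xor b) xor c ≡ true → (not a xor b) xor not c ≡ true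
      flip-parity true  true  true  _ = refl
      flip-parity true  false false _ = refl
      flip-parity false true  false _ = refl
      flip-parity false false true  _ = refl

      flip-parity₂ : ∀ a b → a xor b ≡ true → not a xor not b ≡ true
      flip-parity₂ true  false _ = refl
      flip-parity₂ false true  _ = refl

      -- One lazy step: `a` belongs to resting, `b` to moving. Both have the same normalised bound,
      -- so each lazy step costs a factor 2.
      combine-bounds : ∀ D n t a b s → D * a ≤ t * s → D * b ≤ t * (n * s) → D * (n * a + b) ≤ 2 * t * (n * s)
      combine-bounds D n t a b s p q = begin
        D * (n * a + b)                ≡⟨ lem₁ D n a b ⟩
        n * (D * a) + D * b            ≤⟨ +-mono-≤ (*-monoʳ-≤ n p) q ⟩
        n * (t * s) + t * (n * s)      ≡⟨ lem₂ n t s ⟩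
        2 * t * (n * s)                ∎
        where
        lem₁ : ∀ D n a b → D * (n * a + b) ≡ n * (D * a) + D * b
        lem₁ = solve-∀
        lem₂ : ∀ n t s → n * (t * s) + t * (n * s) ≡ 2 * t * (n * s)
        lem₂ = solve-∀

    -- Each of the 2^j patterns of rests and moves contributes a power of n times some `h L`. The
    -- parity condition makes every L that occurs odd, so `few` applies.
    trace-X : ∀ j p σ → p + j ≤ Lmax → oddᵇ p xor σ ≡ true → D * tr (W p ⊗ X j σ) ≤ 2 ^ j * n ^ (p + j)
    trace-X zero p false p≤ par = begin
      D * tr (W p ⊗ δ)     ≡⟨ cong (D *_) (tr-cong (⊗-δ (W p))) ⟩
      D * h p              ≤⟨ few p (≤-trans (m≤m+n p 0) p≤) (trans (sym (Bool.xor-identityʳ _)) par) ⟩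
      n ^ p                ≡⟨ cong (n ^_) (+-identityʳ p) ⟨
      n ^ (p + 0)          ≡⟨ +-identityʳ _ ⟨
      1 * n ^ (p + 0)      ∎
    trace-X zero p true p≤ par = ≤-trans (≤-reflexive (trans (cong (D *_)
      (trans (sum-cong λ x → trans (sum-cong λ z → *-zeroʳ (W p x z)) (sum-0 n)) (sum-0 n))) (*-zeroʳ D))) z≤n
    trace-X (suc j) p σ p≤ par = begin
      D * tr (W p ⊗ X (suc j) σ)
        ≡⟨ cong (D *_) (trans (tr-cong (≈-trans (⊗-distribˡ (W p) (λ u x → n * X j σ u x) (A ⊗ X j (not σ)))
             (λ x y → cong₂ _+_ (⊗-scaleʳ (W p) (X j σ) n x y) (W⊗A p (X j (not σ)) x y))))
             (trans (tr-+ (λ x y → n * (W p ⊗ X j σ) x y) (W (suc p) ⊗ X j (not σ)))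
                (cong (_+ tr (W (suc p) ⊗ X j (not σ))) (sum-*ˡ n (λ x → (W p ⊗ X j σ) x x))))) ⟩
      D * (n * tr (W p ⊗ X j σ) + tr (W (suc p) ⊗ X j (not σ)))
        ≤⟨ combine-bounds D n (2 ^ j) _ _ (n ^ (p + j))
             (trace-X j p σ (≤-trans (+-monoʳ-≤ p (n≤1+n j)) p≤) par)
             (trace-X j (suc p) (not σ) (≤-trans (≤-reflexive (sym (+-suc p j))) p≤) (flip-parity₂ (oddᵇ p) σ par)) ⟩
      2 ^ suc j * n ^ suc (p + j)  ≡⟨ cong (λ t → 2 ^ suc j * n ^ t) (+-suc p j) ⟨
      2 ^ suc j * n ^ (p + suc j)  ∎

    -- Unfolds the first lazy walk in the same way, pushing its moves onto the middle factor `W p`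
    -- until `trace-X` applies.
    form-X : ∀ i p j σ τ → p + j + i ≤ Lmax → (oddᵇ p xor τ) xor σ ≡ true →
      D * ⟪ X i σ , W p ⊗ X j τ ⟫ ≤ 2 ^ (i + j) * n ^ (p + j + i)
    form-X zero p j false τ p≤ par = begin
      D * ⟪ δ , W p ⊗ X j τ ⟫     ≡⟨ cong (D *_) (⟪δ,⟫ (W p ⊗ X j τ)) ⟩
      D * tr (W p ⊗ X j τ)        ≤⟨ trace-X j p τ (≤-trans (m≤m+n _ 0) p≤) (trans (sym (Bool.xor-identityʳ _)) par) ⟩
      2 ^ j * n ^ (p + j)         ≡⟨ cong (λ t → 2 ^ j * n ^ t) (+-identityʳ (p + j)) ⟨
      2 ^ j * n ^ (p + j + 0)     ∎
    form-X zero p j true τ p≤ par = ≤-trans (≤-reflexive (trans (cong (D *_) (⟪0,⟫ (W p ⊗ X j τ))) (*-zeroʳ D))) z≤n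
    form-X (suc i) p j σ τ p≤ par = begin
      D * ⟪ X (suc i) σ , N ⟫
        ≡⟨ cong (D *_) (trans (⟪⟫-linear n (X i σ) (A ⊗ X i (not σ)) N) (cong (n * ⟪ X i σ , N ⟫ +_)
             (trans (⟪⟫-adjoint (X i (not σ)) N) (⟪⟫-congʳ (X i (not σ)) (A⊗W p (X j τ)))))) ⟩
      D * (n * ⟪ X i σ , N ⟫ + ⟪ X i (not σ) , W (suc p) ⊗ X j τ ⟫)
        ≤⟨ combine-bounds D n (2 ^ (i + j)) _ _ (n ^ (p + j + i))
             (form-X i p j σ τ (≤-trans (+-monoʳ-≤ (p + j) (n≤1+n i)) p≤) par)
             (form-X i (suc p) j (not σ) τ (≤-trans (≤-reflexive (sym (+-suc (p + j) i))) p≤) (flip-parity (oddᵇ p) τ σ par)) ⟩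
      2 ^ suc (i + j) * n ^ suc (p + j + i) ≡⟨ cong (λ t → 2 ^ suc (i + j) * n ^ t) (+-suc (p + j) i) ⟨
      2 ^ suc (i + j) * n ^ (p + j + suc i) ∎
      where N = W p ⊗ X j τ

  -- Pairs of lazy walks from `x` with equal parity and adjacent ends. With the joining edge they
  -- form closed walks at `x` with an odd number of proper steps, hence `sum-Q`.
  q : Bool → ℕ → Fin n → ℕ
  q σ j x = sumF λ u → X j σ u x * (A ⊗ X j σ) u x

  Q : ℕ → Fin n → ℕ
  Q j x = q false j x + q true j x

  sum-Q : ∀ D Lmax → (∀ L → L ≤ Lmax → oddᵇ L ≡ true → D * h L ≤ n ^ L) → ∀ j → suc (j + j) ≤ Lmax →
    D * sumF (Q j) ≤ 2 * 2 ^ (j + j) * (n ^ suc (j + j))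
  sum-Q D Lmax few j j≤ = begin
    D * sumF (Q j)                              ≡⟨ cong (D *_) (sum-+ (q false j) (q true j)) ⟩
    D * (sumF (q false j) + sumF (q true j))    ≡⟨ *-distribˡ-+ D (sumF (q false j)) _ ⟩
    D * sumF (q false j) + D * sumF (q true j)  ≤⟨ +-mono-≤ (part false refl) (part true refl) ⟩
    t + t                                       ≡⟨ lem (2 ^ (j + j)) (n ^ suc (j + j)) ⟩
    2 * 2 ^ (j + j) * n ^ suc (j + j)           ∎
    where
    t = 2 ^ (j + j) * n ^ suc (j + j)
    lem : ∀ a b → a * b + a * b ≡ 2 * a * b
    lem = solve-∀
    part : ∀ σ → (true xor σ) xor σ ≡ true → D * sumF (q σ j) ≤ t
    part σ par = ≤-trans (≤-reflexive (cong (D *_) (⟪⟫-congʳ (X j σ) (⊗-cong {N = X j σ} (≈-sym W-1) (λ _ _ → refl)))))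
      (form-X D Lmax few j 1 j σ σ j≤ par)

-- In the bound on monochromatic pairs, each end loses a factor 2 for its majority parity and e^j ≤
-- e^e for the density of its walks; the last factor `e` is the precision wanted in `mono`.
goodness : ℕ → ℕ
goodness e = 4 * e * (e ^ e * e ^ e)

module Pieces {n : ℕ} {{_ : NonZero n}} (G : Graph n) (e : ℕ) (1≤e : 1 ≤ e) where
  open Walks G
  open Lazy G

  -- Two nested sets are needed to control the edges leaving `C`: an outer end either lies in `C⁺`
  -- outside `C`, which is a small set, or lies outside `C⁺` and sends few edges to `C`.
  record Piece : Set where
    field
      C C⁺ col : Fin n → Bool
      C⊆C⁺     : ∀ v → C v ≡ true → C⁺ v ≡ true
      boundary : e * sumF (λ v → ⟦ C⁺ v ∧ not (C v) ⟧) ≤ n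
      leaving  : ∀ v → C⁺ v ≡ false → e * sumF (λ u → ⟦ adj G v u ∧ C u ⟧) ≤ n
      mono     : e * sumF (λ u → sumF λ v → ⟦ (adj G u v ∧ same (col u) (col v)) ∧ (C u ∧ C v) ⟧) ≤ n * n
  open Piece

  module From (x : Fin n) where

    -- u is reached when the density of lazy walks of length j from x to u is at least e⁻ʲ;
    -- the extra factor n accounts for the two fixed end points.
    reach? : ∀ j u → Dec (n ^ j ≤ e ^ j * (n * Y j u x))
    reach? j u = n ^ j ≤? e ^ j * (n * Y j u x)

    R : ℕ → Fin n → Bool
    R j u = does (reach? j u)

    R-grow : ∀ j u → R j u ≡ true → R (suc j) u ≡ true
    R-grow j u r = dec-true (reach? (suc j) u) (begin
      n * n ^ j                                ≤⟨ *-monoʳ-≤ n (does⇒ (reach? j u) r) ⟩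
      n * (e ^ j * (n * Y j u x))              ≡⟨ lem n (e ^ j) (Y j u x) ⟩
      1 * (e ^ j * (n * (n * Y j u x)))        ≤⟨ *-mono-≤ 1≤e (*-monoʳ-≤ (e ^ j) (*-monoʳ-≤ n (≤-trans (m≤m+n _ _) (≤-reflexive (sym (Y-suc j u x)))))) ⟩
      e * (e ^ j * (n * Y (suc j) u x))        ≡⟨ *-assoc e (e ^ j) _ ⟨
      e ^ suc j * (n * Y (suc j) u x)          ∎)
      where lem : ∀ n p y → n * (p * (n * y)) ≡ 1 * (p * (n * (n * y)))
            lem = solve-∀

    -- This explains the threshold e⁻ʲ: at least n/e reached neighbours pass on at least a 1/e
    -- fraction of their density, exactly what the next level permits.
    R-absorb : ∀ j v → n ≤ e * sumF (λ u → ⟦ adj G v u ∧ R j u ⟧) → R (suc j) v ≡ true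
    R-absorb j v many = dec-true (reach? (suc j) v) (begin
      n * n ^ j                                ≤⟨ *-monoˡ-≤ (n ^ j) many ⟩
      e * N * n ^ j                            ≡⟨ lem₁ e N (n ^ j) ⟩
      e * (n ^ j * N)                          ≡⟨ cong (e *_) (sum-*ˡ (n ^ j) (λ u → ⟦ adj G v u ∧ R j u ⟧)) ⟨
      e * sumF (λ u → n ^ j * ⟦ adj G v u ∧ R j u ⟧) ≤⟨ *-monoʳ-≤ e (sum-mono term) ⟩
      e * sumF (λ u → e ^ j * n * (A v u * Y j u x)) ≡⟨ cong (e *_) (sum-*ˡ (e ^ j * n) (λ u → A v u * Y j u x)) ⟩
      e * (e ^ j * n * (A ⊗ Y j) v x)          ≤⟨ *-monoʳ-≤ e (*-monoʳ-≤ (e ^ j * n) (≤-trans (m≤n+m _ _) (≤-reflexive (sym (Y-suc j v x))))) ⟩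
      e * (e ^ j * n * Y (suc j) v x)          ≡⟨ lem₂ e (e ^ j) n (Y (suc j) v x) ⟩
      e ^ suc j * (n * Y (suc j) v x)          ∎)
      where
      N = sumF (λ u → ⟦ adj G v u ∧ R j u ⟧)
      lem₁ : ∀ a b c → a * b * c ≡ a * (c * b)
      lem₁ = solve-∀
      lem₂ : ∀ a b c d → a * (b * c * d) ≡ a * b * (c * d)
      lem₂ = solve-∀
      term : ∀ u → n ^ j * ⟦ adj G v u ∧ R j u ⟧ ≤ e ^ j * n * (A v u * Y j u x)
      term u with adj G v u
      ... | false = ≤-trans (≤-reflexive (*-zeroʳ (n ^ j))) z≤n
      ... | true = ⟦⟧-elim (n ^ j) (R j u) λ r → ≤-trans (does⇒ (reach? j u) r) (≤-reflexive (lem₃ (e ^ j) n (Y j u x)))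
        where lem₃ : ∀ a b c → a * (b * c) ≡ a * b * (1 * c)
              lem₃ = solve-∀

    -- At level 1 the threshold is so low that the single edge from `x` meets it; resting carries
    -- this to later levels.
    R-neighbour : ∀ j v → adj G x v ≡ true → R (suc j) v ≡ true
    R-neighbour (suc j) v a = R-grow (suc j) v (R-neighbour j v a)
    R-neighbour zero    v a = dec-true (reach? 1 v) (begin
      n * 1                    ≤⟨ *-monoʳ-≤ n positive ⟩
      n * Y 1 v x              ≡⟨ *-identityˡ _ ⟨
      1 * (n * Y 1 v x)        ≤⟨ *-monoˡ-≤ (n * Y 1 v x) (*-mono-≤ 1≤e (≤-refl {1})) ⟩
      e ^ 1 * (n * Y 1 v x)    ∎)
      where
      positive : 1 ≤ Y 1 v x
      positive = begin
        1                            ≡⟨ cong ⟦_⟧ (trans (sym a) (Graph.sym G x v)) ⟩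
        A v x                        ≡⟨ ⊗-δ A v x ⟨
        (A ⊗ δ) v x                  ≡⟨ ⊗-congʳ A (λ u x → sym (+-identityʳ (δ u x))) v x ⟩
        (A ⊗ Y 0) v x                ≤⟨ m≤n+m _ _ ⟩
        n * Y 0 v x + (A ⊗ Y 0) v x  ≡⟨ Y-suc 0 v x ⟨
        Y 1 v x                      ∎

    new : ℕ → ℕ
    new j = sumF (λ v → ⟦ R (suc j) v ∧ not (R j v) ⟧)

    size : ℕ → ℕ
    size j = sumF (λ v → ⟦ R j v ⟧)

    size-suc : ∀ j → size j + new j ≤ size (suc j)
    size-suc j = ≤-trans (≤-reflexive (sym (sum-+ (λ v → ⟦ R j v ⟧) (λ v → ⟦ R (suc j) v ∧ not (R j v) ⟧))))
      (sum-mono λ v → pointwise (R j v) (R (suc j) v) (R-grow j v))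
      where
      pointwise : ∀ a b → (a ≡ true → b ≡ true) → ⟦ a ⟧ + ⟦ b ∧ not a ⟧ ≤ ⟦ b ⟧
      pointwise true  b p rewrite p refl = ≤-refl
      pointwise false b p = ≤-reflexive (cong ⟦_⟧ (Bool.∧-identityʳ b))

    -- If no level is stable, each adds more than n/e vertices. Recording this as `suc n` keeps the
    -- strictness, so that J = e contradicts having only n vertices.
    stabilise : ∀ J → (∃ λ j → j < J × e * new j ≤ n) ⊎ J * suc n ≤ e * size J
    stabilise zero = inj₂ z≤n
    stabilise (suc J) with stabilise J
    ... | inj₁ (j , j<J , p) = inj₁ (j , m<n⇒m<1+n j<J , p)
    ... | inj₂ p with e * new J ≤? n
    ...   | yes q = inj₁ (J , ≤-refl , q)
    ...   | no q  = inj₂ (begin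
      suc n + J * suc n          ≤⟨ +-mono-≤ (≰⇒> q) p ⟩
      e * new J + e * size J     ≡⟨ trans (sym (*-distribˡ-+ e (new J) (size J))) (cong (e *_) (+-comm (new J) (size J))) ⟩
      e * (size J + new J)       ≤⟨ *-monoʳ-≤ e (size-suc J) ⟩
      e * size (suc J)           ∎)

    stable-step : ∃ λ j → j < e × e * new j ≤ n
    stable-step with stabilise e
    ... | inj₁ r = r
    ... | inj₂ p = ⊥-elim (<⇒≱ (*-monoʳ-< e {{>-nonZero 1≤e}} (n<1+n n)) (≤-trans p (*-monoʳ-≤ e
      (≤-trans (sum-≤ (λ v → ⟦⟧≤1 (R e v))) (≤-reflexive (*-identityʳ n))))))

    larger : ℕ → Fin n → Bool
    larger j u = does (X j false u x ≤? X j true u x)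

    larger-half : ∀ j u → Y j u x ≤ 2 * X j (larger j u) u x
    larger-half j u with larger j u in eq
    ... | true  = ≤-trans (+-monoˡ-≤ _ (does⇒ (X j false u x ≤? X j true u x) eq)) (≤-reflexive (double (X j true u x)))
    ... | false = ≤-trans (+-monoʳ-≤ _ (<⇒≤ (≰⇒> (¬does⇒ (X j false u x ≤? X j true u x) eq))))
                          (≤-reflexive (double (X j false u x)))

    monoR : ℕ → Fin n → Fin n → Bool
    monoR j u v = (adj G u v ∧ same (larger j u) (larger j v)) ∧ (R j u ∧ R j v)

    -- The ends of a monochromatic edge share their majority parity, so the product of their
    -- majority walk counts is a term of `Q j x`, and both factors are large because the ends are
    -- reached.
    mono-Q : ∀ j → n ^ j * n ^ j * sumF (λ u → sumF λ v → ⟦ monoR j u v ⟧)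
      ≤ 4 * (e ^ j * e ^ j) * (n * n) * Q j x
    mono-Q j = begin
      p * sumF (λ u → sumF λ v → ⟦ monoR j u v ⟧)
        ≡⟨ trans (sum-cong λ u → sum-*ˡ p (λ v → ⟦ monoR j u v ⟧)) (sum-*ˡ p (λ u → sumF λ v → ⟦ monoR j u v ⟧)) ⟨
      sumF (λ u → sumF λ v → p * ⟦ monoR j u v ⟧)
        ≤⟨ sum-mono (λ u → sum-mono λ v → ⟦⟧-elim p (monoR j u v) (pair u v)) ⟩
      sumF (λ u → sumF λ v → κ * (F false u v + F true u v))
        ≡⟨ trans (sum-cong λ u → sum-*ˡ κ (λ v → F false u v + F true u v)) (sum-*ˡ κ (λ u → sumF λ v → F false u v + F true u v)) ⟩
      κ * sumF (λ u → sumF λ v → F false u v + F true u v)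
        ≡⟨ cong (κ *_) (trans (sum-cong λ u → sum-+ (F false u) (F true u)) (sum-+ (λ u → sumF (F false u)) (λ u → sumF (F true u)))) ⟩
      κ * (sumF (λ u → sumF (F false u)) + sumF (λ u → sumF (F true u)))
        ≡⟨ cong (κ *_) (cong₂ _+_ (form false) (form true)) ⟩
      κ * Q j x ∎
      where
      p = n ^ j * n ^ j
      κ = 4 * (e ^ j * e ^ j) * (n * n)
      F : Bool → Fin n → Fin n → ℕ
      F σ u v = X j σ u x * (A u v * X j σ v x)
      form : ∀ σ → sumF (λ u → sumF (F σ u)) ≡ q σ j x
      form σ = sum-cong λ u → sum-*ˡ (X j σ u x) (λ v → A u v * X j σ v x)
      F≤ : ∀ σ u v → F σ u v ≤ F false u v + F true u v
      F≤ false u v = m≤m+n _ _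
      F≤ true  u v = m≤n+m _ _
      reach : ∀ u → R j u ≡ true → n ^ j ≤ e ^ j * (n * (2 * X j (larger j u) u x))
      reach u r = ≤-trans (does⇒ (reach? j u) r) (*-monoʳ-≤ (e ^ j) (*-monoʳ-≤ n (larger-half j u)))
      lem : ∀ e n a b → e * (n * (2 * a)) * (e * (n * (2 * b))) ≡ 4 * (e * e) * (n * n) * (a * (1 * b))
      lem = solve-∀
      pair : ∀ u v → monoR j u v ≡ true → p ≤ κ * (F false u v + F true u v)
      pair u v m = begin
        n ^ j * n ^ j ≤⟨ *-mono-≤ (reach u ru) (reach v rv) ⟩
        e ^ j * (n * (2 * X j (larger j u) u x)) * (e ^ j * (n * (2 * X j (larger j v) v x)))
          ≡⟨ lem (e ^ j) n (X j (larger j u) u x) (X j (larger j v) v x) ⟩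
        κ * (X j (larger j u) u x * (1 * X j (larger j v) v x))
          ≡⟨ cong₂ (λ a σ → κ * (X j (larger j u) u x * (a * X j σ v x))) (cong ⟦_⟧ (sym auv)) (sym eq) ⟩
        κ * F (larger j u) u v   ≤⟨ *-monoʳ-≤ κ (F≤ (larger j u) u v) ⟩
        κ * (F false u v + F true u v) ∎
        where
        m₁ = Bool.∧-conicalˡ (adj G u v ∧ same (larger j u) (larger j v)) _ m
        m₂ = Bool.∧-conicalʳ (adj G u v ∧ same (larger j u) (larger j v)) _ m
        auv = Bool.∧-conicalˡ (adj G u v) _ m₁
        eq = same⇒≡ (larger j u) (larger j v) (Bool.∧-conicalʳ (adj G u v) _ m₁)
        ru = Bool.∧-conicalˡ (R j u) _ m₂
        rv = Bool.∧-conicalʳ (R j u) _ m₂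

  Good : Fin n → Set
  Good x = ∀ j → j < e → goodness e * Q j x ≤ n ^ j * n ^ j

  piece : ∀ x → Good x → Σ Piece λ P → ∀ v → adj G x v ≡ true → C⁺ P v ≡ true
  piece x good = record
    { C = R j ; C⁺ = R (suc j) ; col = larger j
    ; C⊆C⁺ = R-grow j
    ; boundary = few
    -- A vertex with more than n/e neighbours in `R j` would have been absorbed at level `suc j`.
    ; leaving = λ v r → <⇒≤ (≰⇒> λ many → case trans (sym r) (R-absorb j v many) of λ ())
    ; mono = *-cancelˡ-≤ (n ^ j * n ^ j) (begin
        n ^ j * n ^ j * (e * M)                          ≡⟨ lem₁ (n ^ j * n ^ j) e M ⟩
        e * (n ^ j * n ^ j * M)                          ≤⟨ *-monoʳ-≤ e (mono-Q j) ⟩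
        e * (4 * (e ^ j * e ^ j) * (n * n) * Q j x)      ≡⟨ lem₂ e (e ^ j * e ^ j) (n * n) (Q j x) ⟩
        4 * e * (e ^ j * e ^ j) * Q j x * (n * n)        ≤⟨ *-monoˡ-≤ (n * n) (*-monoˡ-≤ (Q j x) (*-monoʳ-≤ (4 * e) (*-mono-≤ pow pow))) ⟩
        goodness e * Q j x * (n * n)                             ≤⟨ *-monoˡ-≤ (n * n) (good j j<e) ⟩
        n ^ j * n ^ j * (n * n)                          ∎)
    } , λ v → R-neighbour j v
    where
    open From x
    j = proj₁ stable-step
    j<e = proj₁ (proj₂ stable-step)
    few = proj₂ (proj₂ stable-step)
    M = sumF (λ u → sumF λ v → ⟦ monoR j u v ⟧)
    instance
      e≢0 : NonZero e
      e≢0 = >-nonZero 1≤e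
      n^j≢0 : NonZero (n ^ j)
      n^j≢0 = m^n≢0 n j
      n^jn^j≢0 : NonZero (n ^ j * n ^ j)
      n^jn^j≢0 = m*n≢0 (n ^ j) (n ^ j)
    pow : e ^ j ≤ e ^ e
    pow = ^-monoʳ-≤ e (<⇒≤ j<e)
    lem₁ : ∀ a b c → a * (b * c) ≡ b * (a * c)
    lem₁ = solve-∀
    lem₂ : ∀ e p s q → e * (4 * p * s * q) ≡ 4 * e * p * q * s
    lem₂ = solve-∀

-- Covering the graph by nearly bipartite pieces

private
  drop : ∀ b m → ⟦ b ⟧ ≤ suc m
  drop b m = ≤-trans (⟦⟧≤1 b) (s≤s z≤n)

-- Each position of u and v relative to C ⊆ C⁺ has a summand that pays for the pair uv.
pair-cases : ∀ a cu cu⁺ cv cv⁺ pu pv ru rv ku kv → (cu ≡ true → cu⁺ ≡ true) → (cv ≡ true → cv⁺ ≡ true) →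
  ⟦ (a ∧ same (if cu then pu else ru) (if cv then pv else rv)) ∧ ((cu⁺ ∨ ku) ∧ (cv⁺ ∨ kv)) ⟧ ≤
    (⟦ cu⁺ ∧ not cu ⟧ + ⟦ cv⁺ ∧ not cv ⟧) + (⟦ (a ∧ same pu pv) ∧ (cu ∧ cv) ⟧ +
    ((⟦ not cv⁺ ⟧ * ⟦ a ∧ cu ⟧ + ⟦ not cu⁺ ⟧ * ⟦ a ∧ cv ⟧) + ⟦ (a ∧ same ru rv) ∧ (ku ∧ kv) ⟧))
pair-cases false cu cu⁺ cv cv⁺ pu pv ru rv ku kv f g = z≤n
pair-cases true true false cv cv⁺ pu pv ru rv ku kv f g with f refl
... | ()
pair-cases true cu cu⁺ true false pu pv ru rv ku kv f g with g refl
... | ()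
pair-cases true false true cv cv⁺ pu pv ru rv ku kv f g = drop _ _
pair-cases true true true false true pu pv ru rv ku kv f g = drop _ _
pair-cases true false false false true pu pv ru rv ku kv f g = drop _ _
pair-cases true true true true true pu pv ru rv ku kv f g = m≤m+n _ _
pair-cases true true true false false pu pv ru rv ku kv f g =
  ≤-trans (drop (same pu rv ∧ kv) 0) (≤-trans (m≤m+n 1 _) (m≤n+m _ ⟦ same pu pv ∧ false ⟧))
pair-cases true false false true true pu pv ru rv ku kv f g =
  ≤-trans (drop (same ru pv ∧ (ku ∧ true)) 0) (≤-trans (m≤m+n 1 _) (m≤n+m _ ⟦ same pu pv ∧ false ⟧))
pair-cases true false false false false pu pv ru rv ku kv f g = m≤n+m _ ⟦ same pu pv ∧ false ⟧

-- `goodness` times the constant in `sum-Q` at the largest level.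
weight : ℕ → ℕ
weight e = goodness e * (2 * 2 ^ (e + e))

module Cover {n : ℕ} {{_ : NonZero n}} (G : Graph n) (e : ℕ) (1≤e : 1 ≤ e) where
  open Walks G
  open Lazy G
  open Pieces G e 1≤e
  open Piece

  private instance
    e≢0 : NonZero e
    e≢0 = >-nonZero 1≤e

  bad? : ∀ x → Dec (∃ λ (j : Fin e) → n ^ toℕ j * n ^ toℕ j < goodness e * Q (toℕ j) x)
  bad? x = Fin.any? λ j → n ^ toℕ j * n ^ toℕ j <? goodness e * Q (toℕ j) x

  bad : Fin n → Bool
  bad x = does (bad? x)

  good : ∀ x → bad x ≡ false → Good x
  good x b j j<e = ≮⇒≥ λ lt → ¬does⇒ (bad? x) b (Fin.fromℕ< j<e ,
    subst (λ t → n ^ t * n ^ t < goodness e * Q t x) (sym (Fin.toℕ-fromℕ< j<e)) lt)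

  -- Markov's inequality at each level. In `e * e * weight e`, one factor `e` pays for the union
  -- over the e levels and the other for the final bound n/e.
  bad-few : (∀ L → L ≤ suc (e + e) → oddᵇ L ≡ true → e * e * weight e * h L ≤ n ^ L) →
    e * sumF (λ x → ⟦ bad x ⟧) ≤ n
  bad-few few = *-cancelˡ-≤ e (begin
    e * (e * sumF (λ x → ⟦ bad x ⟧))                           ≡⟨ *-assoc e e _ ⟨
    e * e * sumF (λ x → ⟦ bad x ⟧)                             ≤⟨ *-monoʳ-≤ (e * e) (sum-mono union) ⟩
    e * e * sumF (λ x → sumF (λ j → b j x))                    ≡⟨ cong (e * e *_) (sum-swap (λ x j → b j x)) ⟩
    e * e * sumF (λ j → sumF (b j))                            ≡⟨ sum-*ˡ (e * e) (λ j → sumF (b j)) ⟨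
    sumF (λ j → e * e * sumF (b j))                            ≤⟨ sum-≤ level ⟩
    e * n                                                      ∎)
    where
    b? : ∀ j x → Dec (n ^ toℕ j * n ^ toℕ j < goodness e * Q (toℕ j) x)
    b? j x = n ^ toℕ j * n ^ toℕ j <? goodness e * Q (toℕ j) x
    b : Fin e → Fin n → ℕ
    b j x = ⟦ does (b? j x) ⟧
    union : ∀ x → ⟦ bad x ⟧ ≤ sumF (λ j → b j x)
    union x = ≤-trans (≤-reflexive (sym (+-identityʳ _))) (⟦⟧-elim 1 (bad x) λ t → let (j , p) = does⇒ (bad? x) t in
      ≤-trans (≤-reflexive (sym (cong ⟦_⟧ (dec-true (b? j x) p)))) (term≤sum (λ j → b j x) j))
    instance
      gd≢0 : NonZero (goodness e)
      gd≢0 = m*n≢0 (4 * e) (e ^ e * e ^ e) {{m*n≢0 4 e}} {{m*n≢0 (e ^ e) (e ^ e) {{m^n≢0 e e}} {{m^n≢0 e e}}}}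
      weight≢0 : NonZero (weight e)
      weight≢0 = m*n≢0 (goodness e) (2 * 2 ^ (e + e)) {{gd≢0}} {{m*n≢0 2 (2 ^ (e + e)) {{_}} {{m^n≢0 2 (e + e)}}}}
    level : ∀ j → e * e * sumF (b j) ≤ n
    level k = *-cancelˡ-≤ (weight e * s) {{m*n≢0 (weight e) s {{weight≢0}} {{s≢0}}}} (begin
      weight e * s * (e * e * B)                ≡⟨ lem₁ (weight e) s (e * e) B ⟩
      D * (s * B)                             ≡⟨ cong (D *_) (sum-*ˡ s (b k)) ⟨
      D * sumF (λ x → s * b k x)              ≤⟨ *-monoʳ-≤ D (sum-mono λ x → ⟦⟧-elim s (does (b? k x)) λ t → <⇒≤ (does⇒ (b? k x) t)) ⟩
      D * sumF (λ x → goodness e * Q j x)             ≡⟨ cong (D *_) (sum-*ˡ (goodness e) (Q j)) ⟩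
      D * (goodness e * sumF (Q j))                   ≡⟨ lem₂ D (goodness e) _ ⟩
      goodness e * (D * sumF (Q j))                   ≤⟨ *-monoʳ-≤ (goodness e) (sum-Q D (suc (e + e)) few j (s≤s (+-mono-≤ j≤e j≤e))) ⟩
      goodness e * (2 * 2 ^ (j + j) * n ^ suc (j + j)) ≤⟨ *-monoʳ-≤ (goodness e) (*-monoˡ-≤ (n ^ suc (j + j)) (*-monoʳ-≤ 2 (^-monoʳ-≤ 2 (+-mono-≤ j≤e j≤e)))) ⟩
      goodness e * (2 * 2 ^ (e + e) * n ^ suc (j + j)) ≡⟨ cong (λ t → goodness e * (2 * 2 ^ (e + e) * (n * t))) (^-distribˡ-+-* n j j) ⟩
      goodness e * (2 * 2 ^ (e + e) * (n * s))        ≡⟨ lem₃ (goodness e) (2 * 2 ^ (e + e)) n s ⟩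
      weight e * s * n                          ∎)
      where
      j = toℕ k
      j≤e = <⇒≤ (Fin.toℕ<n k)
      s = n ^ j * n ^ j
      s≢0 : NonZero s
      s≢0 = m*n≢0 (n ^ j) (n ^ j) {{m^n≢0 n j}} {{m^n≢0 n j}}
      B = sumF (b k)
      D = e * e * weight e
      lem₁ : ∀ w s e b → w * s * (e * b) ≡ e * w * (s * b)
      lem₁ = solve-∀
      lem₂ : ∀ a b c → a * (b * c) ≡ b * (a * c)
      lem₂ = solve-∀
      lem₃ : ∀ g t n s → g * (t * (n * s)) ≡ g * t * s * n
      lem₃ = solve-∀

  cov : List Piece → Fin n → Bool
  cov []       v = false
  cov (P ∷ Ps) v = C⁺ P v ∨ cov Ps v

  -- The most recent piece whose `C` contains the vertex decides, whereas `cov` uses `C⁺`. The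
  -- mismatch is confined to the small boundaries.
  colour : List Piece → Fin n → Bool
  colour []       v = false
  colour (P ∷ Ps) v = if C P v then col P v else colour Ps v

  Σ² : (Fin n → Fin n → ℕ) → ℕ
  Σ² f = sumF λ u → sumF (f u)

  Σ²-+ : ∀ f g → Σ² (λ u v → f u v + g u v) ≡ Σ² f + Σ² g
  Σ²-+ f g = trans (sum-cong λ u → sum-+ (f u) (g u)) (sum-+ (λ u → sumF (f u)) (λ u → sumF (g u)))

  Σ²-mono : ∀ {f g} → (∀ u v → f u v ≤ g u v) → Σ² f ≤ Σ² g
  Σ²-mono p = sum-mono λ u → sum-mono (p u)

  e-sum : ∀ {f : Fin n → ℕ} {k} → (∀ u → e * f u ≤ k) → e * sumF f ≤ n * k
  e-sum {f} p = ≤-trans (≤-reflexive (sym (sum-*ˡ e f))) (sum-≤ p)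

  rows : ∀ (f : Fin n → ℕ) → e * sumF f ≤ n → e * Σ² (λ u v → f u) ≤ n * n
  rows f p = ≤-trans (≤-reflexive (cong (e *_) (sum-swap {n} {n} (λ u v → f u)))) (e-sum {λ v → sumF f} λ _ → p)

  cols : ∀ (f : Fin n → ℕ) → e * sumF f ≤ n → e * Σ² (λ u v → f v) ≤ n * n
  cols f p = e-sum {λ u → sumF f} λ _ → p

  monoPairs : List Piece → ℕ
  monoPairs Ps = Σ² λ u v → ⟦ (adj G u v ∧ same (colour Ps u) (colour Ps v)) ∧ (cov Ps u ∧ cov Ps v) ⟧

  -- A new piece costs at most 5n²/e pairs: boundary at either end, monochromatic inside `C`, and
  -- edges leaving `C` in either direction.
  monoPairs-bound : ∀ Ps → e * monoPairs Ps ≤ 5 * length Ps * (n * n)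
  monoPairs-bound [] = ≤-reflexive (trans (cong (e *_) (trans (sum-cong λ u → trans (sum-cong λ v →
    cong ⟦_⟧ (Bool.∧-zeroʳ (adj G u v ∧ true))) (sum-0 n)) (sum-0 n))) (*-zeroʳ e))
  monoPairs-bound (P ∷ Ps) = begin
    e * monoPairs (P ∷ Ps)
      ≤⟨ *-monoʳ-≤ e (Σ²-mono λ u v → pair-cases (adj G u v) (C P u) (C⁺ P u) (C P v) (C⁺ P v) (col P u) (col P v)
            (colour Ps u) (colour Ps v) (cov Ps u) (cov Ps v) (C⊆C⁺ P u) (C⊆C⁺ P v)) ⟩
    e * Σ² (λ u v → (f₁ u v + f₂ u v) + (f₃ u v + ((f₄ u v + f₅ u v) + f₆ u v)))
      ≡⟨ cong (e *_) (trans (Σ²-+ (λ u v → f₁ u v + f₂ u v) (λ u v → f₃ u v + ((f₄ u v + f₅ u v) + f₆ u v)))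
           (cong₂ _+_ (Σ²-+ f₁ f₂) (trans (Σ²-+ f₃ (λ u v → (f₄ u v + f₅ u v) + f₆ u v))
             (cong (Σ² f₃ +_) (trans (Σ²-+ (λ u v → f₄ u v + f₅ u v) f₆) (cong (_+ Σ² f₆) (Σ²-+ f₄ f₅))))))) ⟩
    e * ((Σ² f₁ + Σ² f₂) + (Σ² f₃ + ((Σ² f₄ + Σ² f₅) + Σ² f₆)))
      ≡⟨ lem₁ e (Σ² f₁) (Σ² f₂) (Σ² f₃) (Σ² f₄) (Σ² f₅) (Σ² f₆) ⟩
    (e * Σ² f₁ + e * Σ² f₂) + (e * Σ² f₃ + ((e * Σ² f₄ + e * Σ² f₅) + e * Σ² f₆))
      ≤⟨ +-mono-≤ (+-mono-≤ (rows _ (boundary P)) (cols _ (boundary P)))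
           (+-mono-≤ (mono P) (+-mono-≤ (+-mono-≤ leave′ leave) (monoPairs-bound Ps))) ⟩
    (n * n + n * n) + (n * n + ((n * n + n * n) + 5 * length Ps * (n * n)))
      ≡⟨ lem₂ (n * n) (length Ps) ⟩
    5 * suc (length Ps) * (n * n) ∎
    where
    f₁ f₂ f₃ f₄ f₅ f₆ : Fin n → Fin n → ℕ
    f₁ u v = ⟦ C⁺ P u ∧ not (C P u) ⟧
    f₂ u v = ⟦ C⁺ P v ∧ not (C P v) ⟧
    f₃ u v = ⟦ (adj G u v ∧ same (col P u) (col P v)) ∧ (C P u ∧ C P v) ⟧
    f₄ u v = ⟦ not (C⁺ P v) ⟧ * ⟦ adj G u v ∧ C P u ⟧
    f₅ u v = ⟦ not (C⁺ P u) ⟧ * ⟦ adj G u v ∧ C P v ⟧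
    f₆ u v = ⟦ (adj G u v ∧ same (colour Ps u) (colour Ps v)) ∧ (cov Ps u ∧ cov Ps v) ⟧
    lem₁ : ∀ e a b c d f g → e * ((a + b) + (c + ((d + f) + g))) ≡ (e * a + e * b) + (e * c + ((e * d + e * f) + e * g))
    lem₁ = solve-∀
    lem₂ : ∀ m k → (m + m) + (m + ((m + m) + 5 * k * m)) ≡ 5 * suc k * m
    lem₂ = solve-∀
    leave : e * Σ² f₅ ≤ n * n
    leave = e-sum {λ u → sumF (f₅ u)} λ u → ≤-trans (≤-reflexive (cong (e *_) (sum-*ˡ ⟦ not (C⁺ P u) ⟧ (λ v → ⟦ adj G u v ∧ C P v ⟧)))) (row u)
      where
      row : ∀ u → e * (⟦ not (C⁺ P u) ⟧ * sumF (λ v → ⟦ adj G u v ∧ C P v ⟧)) ≤ n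
      row u with C⁺ P u in eq
      ... | true  = ≤-trans (≤-reflexive (*-zeroʳ e)) z≤n
      ... | false = ≤-trans (≤-reflexive (cong (e *_) (+-identityʳ _))) (leaving P u eq)
    leave′ : e * Σ² f₄ ≤ n * n
    leave′ = ≤-trans (≤-reflexive (cong (e *_) (trans (sum-swap f₄) (sum-cong λ v → sum-cong λ u →
      cong (λ t → ⟦ not (C⁺ P v) ⟧ * ⟦ t ∧ C P u ⟧) (Graph.sym G u v))))) leave

  -- For each piece, a covered neighbour is in `C`, which receives few edges from a vertex outside
  -- `C⁺`, or in the boundary.
  covered-neighbours : ∀ Ps x → cov Ps x ≡ false →
    e * sumF (λ v → ⟦ adj G x v ∧ cov Ps v ⟧) ≤ 2 * length Ps * n
  covered-neighbours [] x p = ≤-reflexive (trans (cong (e *_) (trans (sum-cong λ v → cong ⟦_⟧ (Bool.∧-zeroʳ (adj G x v))) (sum-0 n))) (*-zeroʳ e))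
  covered-neighbours (P ∷ Ps) x p = begin
    e * sumF (λ v → ⟦ adj G x v ∧ (C⁺ P v ∨ cov Ps v) ⟧)
      ≤⟨ *-monoʳ-≤ e (sum-mono λ v → pointwise (adj G x v) (C P v) (C⁺ P v) (cov Ps v)) ⟩
    e * sumF (λ v → f₁ v + (f₂ v + f₃ v))
      ≡⟨ cong (e *_) (trans (sum-+ f₁ (λ v → f₂ v + f₃ v)) (cong (sumF f₁ +_) (sum-+ f₂ f₃))) ⟩
    e * (sumF f₁ + (sumF f₂ + sumF f₃))
      ≡⟨ lem₁ e (sumF f₁) (sumF f₂) (sumF f₃) ⟩
    e * sumF f₁ + (e * sumF f₂ + e * sumF f₃)
      ≤⟨ +-mono-≤ (leaving P x (Bool.∨-conicalˡ _ _ p)) (+-mono-≤ (boundary P) (covered-neighbours Ps x (Bool.∨-conicalʳ _ _ p))) ⟩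
    n + (n + 2 * length Ps * n) ≡⟨ lem₂ n (length Ps) ⟩
    2 * suc (length Ps) * n ∎
    where
    f₁ f₂ f₃ : Fin n → ℕ
    f₁ v = ⟦ adj G x v ∧ C P v ⟧
    f₂ v = ⟦ C⁺ P v ∧ not (C P v) ⟧
    f₃ v = ⟦ adj G x v ∧ cov Ps v ⟧
    pointwise : ∀ a c c⁺ k → ⟦ a ∧ (c⁺ ∨ k) ⟧ ≤ ⟦ a ∧ c ⟧ + (⟦ c⁺ ∧ not c ⟧ + ⟦ a ∧ k ⟧)
    pointwise false c c⁺ k = z≤n
    pointwise true true c⁺ k = drop (c⁺ ∨ k) _
    pointwise true false true k = s≤s z≤n
    pointwise true false false k = ≤-refl
    lem₁ : ∀ e a b c → e * (a + (b + c)) ≡ e * a + (e * b + e * c)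
    lem₁ = solve-∀
    lem₂ : ∀ n k → n + (n + 2 * k * n) ≡ 2 * suc k * n
    lem₂ = solve-∀

  module Greedy (r : ℕ) (degs : ∀ v → n ≤ r * deg G v) (8r²≤e : 4 * r * (2 * r) ≤ e) where

    size : List Piece → ℕ
    size Ps = sumF (λ v → ⟦ cov Ps v ⟧)

    size≤ : ∀ Ps → size Ps ≤ n
    size≤ Ps = ≤-trans (sum-≤ λ v → ⟦⟧≤1 (cov Ps v)) (≤-reflexive (*-identityʳ n))

    length≤ : ∀ Ps → length Ps * n ≤ 2 * r * size Ps → length Ps ≤ 2 * r
    length≤ Ps inv = *-cancelʳ-≤ (length Ps) (2 * r) n (≤-trans inv (*-monoʳ-≤ (2 * r) (size≤ Ps)))

    -- Invariant: each piece has added at least n/(2r) vertices, so there are never more than 2r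
    -- pieces. An uncovered `x` then has at most 4rn/e ≤ n/(2r) covered neighbours, by 8r² ≤ e. Its
    -- degree is at least n/r, so at least n/(2r) neighbours are new, and the piece of `x` covers
    -- them.
    grow : ∀ Ps x P → length Ps * n ≤ 2 * r * size Ps → cov Ps x ≡ false →
      (∀ v → adj G x v ≡ true → C⁺ P v ≡ true) → length (P ∷ Ps) * n ≤ 2 * r * size (P ∷ Ps)
    grow Ps x P inv unc nbr = begin
      n + length Ps * n              ≤⟨ +-mono-≤ fresh inv ⟩
      2 * r * N + 2 * r * size Ps    ≡⟨ *-distribˡ-+ (2 * r) N (size Ps) ⟨
      2 * r * (N + size Ps)          ≤⟨ *-monoʳ-≤ (2 * r) (≤-trans (≤-reflexive (sym (sum-+ f (λ v → ⟦ cov Ps v ⟧))))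
                                          (sum-mono λ v → pointwise (adj G x v) (C⁺ P v) (cov Ps v) (nbr v))) ⟩
      2 * r * size (P ∷ Ps)          ∎
      where
      f : Fin n → ℕ
      f v = ⟦ adj G x v ∧ not (cov Ps v) ⟧
      N I : ℕ
      N = sumF f
      I = sumF (λ v → ⟦ adj G x v ∧ cov Ps v ⟧)
      pointwise : ∀ a c k → (a ≡ true → c ≡ true) → ⟦ a ∧ not k ⟧ + ⟦ k ⟧ ≤ ⟦ c ∨ k ⟧
      pointwise false c true  p = ≤-reflexive (cong ⟦_⟧ (sym (Bool.∨-zeroʳ c)))
      pointwise false c false p = z≤n
      pointwise true  c k     p rewrite p refl = aux k
        where aux : ∀ k → ⟦ not k ⟧ + ⟦ k ⟧ ≤ 1
              aux true  = ≤-refl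
              aux false = ≤-refl
      degree : deg G x ≡ N + I
      degree = trans (count-sum (adj G x)) (trans (sum-cong λ v → aux (adj G x v) (cov Ps v)) (sum-+ f (λ v → ⟦ adj G x v ∧ cov Ps v ⟧)))
        where aux : ∀ a k → ⟦ a ⟧ ≡ ⟦ a ∧ not k ⟧ + ⟦ a ∧ k ⟧
              aux false k = refl
              aux true true = refl
              aux true false = refl
      few : 2 * r * I ≤ n
      few = *-cancelˡ-≤ e (begin
        e * (2 * r * I)                 ≡⟨ lem₁ e r I ⟩
        2 * r * (e * I)                 ≤⟨ *-monoʳ-≤ (2 * r) (covered-neighbours Ps x unc) ⟩
        2 * r * (2 * length Ps * n)     ≡⟨ lem₂ r (length Ps) n ⟩
        4 * r * length Ps * n           ≤⟨ *-monoˡ-≤ n (*-monoʳ-≤ (4 * r) (length≤ Ps inv)) ⟩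
        4 * r * (2 * r) * n             ≤⟨ *-monoˡ-≤ n 8r²≤e ⟩
        e * n ∎)
        where
        lem₁ : ∀ e r i → e * (2 * r * i) ≡ 2 * r * (e * i)
        lem₁ = solve-∀
        lem₂ : ∀ r l n → 2 * r * (2 * l * n) ≡ 4 * r * l * n
        lem₂ = solve-∀
      fresh : n ≤ 2 * r * N
      fresh = +-cancelʳ-≤ n n (2 * r * N) (begin
        n + n                      ≤⟨ +-mono-≤ (degs x) (degs x) ⟩
        r * deg G x + r * deg G x  ≡⟨ cong (λ t → r * t + r * t) degree ⟩
        r * (N + I) + r * (N + I)  ≡⟨ lem r N I ⟩
        2 * r * N + 2 * r * I      ≤⟨ +-monoʳ-≤ (2 * r * N) few ⟩
        2 * r * N + n              ∎)
        where lem : ∀ r a b → r * (a + b) + r * (a + b) ≡ 2 * r * a + 2 * r * b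
              lem = solve-∀

    cover : ∃ λ Ps → length Ps ≤ 2 * r × (∀ x → bad x ≡ false → cov Ps x ≡ true)
    cover = go (suc (2 * r)) [] (+-identityʳ _) z≤n
      where
      go : ∀ fuel Ps → fuel + length Ps ≡ suc (2 * r) → length Ps * n ≤ 2 * r * size Ps →
        ∃ λ Ps → length Ps ≤ 2 * r × (∀ x → bad x ≡ false → cov Ps x ≡ true)
      go zero Ps eq inv = ⊥-elim (<⇒≱ (≤-reflexive (sym eq)) (length≤ Ps inv))
      go (suc fuel) Ps eq inv with Fin.any? (λ x → (bad x ∨ cov Ps x) Bool.≟ false)
      ... | no none = Ps , length≤ Ps inv , λ x b → Bool.¬-not λ c → none (x , cong₂ _∨_ b c)
      ... | yes (x , p) with piece x (good x (Bool.∨-conicalˡ _ _ p))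
      ...   | P , nbr = go fuel (P ∷ Ps) (trans (+-suc fuel (length Ps)) eq) (grow Ps x P inv (Bool.∨-conicalʳ _ _ p) nbr)

    -- The 2 pays for pairs with a bad first or second vertex, and 10r for at most 2r pieces at 5
    -- each.
    near-bipartite : (∀ L → L ≤ suc (e + e) → oddᵇ L ≡ true → e * e * weight e * h L ≤ n ^ L) →
      ∃ λ c → e * Σ² (λ u v → ⟦ adj G u v ∧ same (c u) (c v) ⟧) ≤ (2 + 10 * r) * (n * n)
    near-bipartite few with cover
    ... | Ps , len , covers = colour Ps , (begin
      e * Σ² (λ u v → ⟦ m u v ⟧)
        ≤⟨ *-monoʳ-≤ e (Σ²-mono λ u v → pointwise (m u v) (bad u) (bad v) (cov Ps u) (cov Ps v) (covers u) (covers v)) ⟩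
      e * Σ² (λ u v → ⟦ bad u ⟧ + (⟦ bad v ⟧ + f u v))
        ≡⟨ cong (e *_) (trans (Σ²-+ (λ u v → ⟦ bad u ⟧) (λ u v → ⟦ bad v ⟧ + f u v))
             (cong (Σ² (λ u v → ⟦ bad u ⟧) +_) (Σ²-+ (λ u v → ⟦ bad v ⟧) f))) ⟩
      e * (Σ² (λ u v → ⟦ bad u ⟧) + (Σ² (λ u v → ⟦ bad v ⟧) + monoPairs Ps))
        ≡⟨ lem₁ e (Σ² (λ u v → ⟦ bad u ⟧)) (Σ² (λ u v → ⟦ bad v ⟧)) (monoPairs Ps) ⟩
      e * Σ² (λ u v → ⟦ bad u ⟧) + (e * Σ² (λ u v → ⟦ bad v ⟧) + e * monoPairs Ps)
        ≤⟨ +-mono-≤ (rows _ (bad-few few)) (+-mono-≤ (cols _ (bad-few few)) (monoPairs-bound Ps)) ⟩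
      n * n + (n * n + 5 * length Ps * (n * n))
        ≤⟨ +-monoʳ-≤ (n * n) (+-monoʳ-≤ (n * n) (*-monoˡ-≤ (n * n) (*-monoʳ-≤ 5 len))) ⟩
      n * n + (n * n + 5 * (2 * r) * (n * n))
        ≡⟨ lem₂ (n * n) r ⟩
      (2 + 10 * r) * (n * n) ∎)
      where
      m : Fin n → Fin n → Bool
      m u v = adj G u v ∧ same (colour Ps u) (colour Ps v)
      f : Fin n → Fin n → ℕ
      f u v = ⟦ m u v ∧ (cov Ps u ∧ cov Ps v) ⟧
      pointwise : ∀ a bu bv ku kv → (bu ≡ false → ku ≡ true) → (bv ≡ false → kv ≡ true) →
        ⟦ a ⟧ ≤ ⟦ bu ⟧ + (⟦ bv ⟧ + ⟦ a ∧ (ku ∧ kv) ⟧)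
      pointwise a true  bv    ku kv p q = drop a _
      pointwise a false true  ku kv p q = drop a _
      pointwise a false false ku kv p q rewrite p refl | q refl = ≤-reflexive (cong ⟦_⟧ (sym (Bool.∧-identityʳ a)))
      lem₁ : ∀ e a b c → e * (a + (b + c)) ≡ e * a + (e * b + e * c)
      lem₁ = solve-∀
      lem₂ : ∀ m r → m + (m + 5 * (2 * r) * m) ≡ (2 + 10 * r) * m
      lem₂ = solve-∀

-- Homomorphisms into odd cycles

anyVec? : ∀ {m} k {P : Vec (Fin m) k → Set} → (∀ c → Dec (P c)) → Dec (∃ P)
anyVec? zero    P? = map′ ([] ,_) (λ { ([] , p) → p }) (P? [])
anyVec? (suc k) P? = map′ (λ { (x , c , p) → x ∷ c , p }) (λ { (x ∷ c , p) → x , c , p })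
  (Fin.any? λ x → anyVec? k λ c → P? (x ∷ c))

-- Exhaustive search over tuples; this decidability is what makes the least `g` computable.
hom? : ∀ {k m} (H : Graph k) (R : Fin m → Fin m → Bool) → Dec (Hom H R)
hom? {k} H R = map′ (λ (c , p) → lookup c , p)
  (λ (φ , p) → tabulate φ , λ u v e → trans (cong₂ R (lookup∘tabulate φ u) (lookup∘tabulate φ v)) (p u v e))
  (anyVec? k λ c → Fin.all? λ u → Fin.all? λ v → (adj H u v Bool.≟ true) →-dec (R (lookup c u) (lookup c v) Bool.≟ true))

side : Bool → Fin 2
side false = zero
side true  = suc zero

side-proper : ∀ a b → a ≢ b → K 2 (side a) (side b) ≡ true
side-proper true  true  p = ⊥-elim (p refl)
side-proper true  false p = refl
side-proper false true  p = refl
side-proper false false p = ⊥-elim (p refl)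

side⁻¹ : Fin 2 → Bool
side⁻¹ zero    = false
side⁻¹ (suc _) = true

side⁻¹-proper : ∀ i j → K 2 i j ≡ true → side⁻¹ i ≢ side⁻¹ j
side⁻¹-proper zero       (suc zero) _ ()
side⁻¹-proper (suc zero) zero       _ ()
side⁻¹-proper (suc zero) (suc zero) ()

missed : ∀ {k m} → k < m → (φ : Fin k → Fin m) → ∃ λ i → ∀ u → φ u ≢ i
missed {k} {m} k<m φ with Fin.any? (λ i → Fin.all? λ u → ¬? (φ u Fin.≟ i))
... | yes r = r
... | no none = ⊥-elim (<⇒≱ k<m (Fin.injective⇒≤ {f = pre} λ {i} {j} eq → trans (sym (hit i)) (trans (cong φ eq) (hit j))))
  where
  preimage : ∀ i → ∃ λ u → φ u ≡ i
  preimage i with Fin.any? (λ u → φ u Fin.≟ i)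
  ... | yes r = r
  ... | no ¬r = ⊥-elim (none (i , λ u eq → ¬r (u , eq)))
  pre : Fin m → Fin k
  pre i = proj₁ (preimage i)
  hit : ∀ i → φ (pre i) ≡ i
  hit i = proj₂ (preimage i)

oddᵇ-even : ∀ m → oddᵇ (2 * m) ≡ false
oddᵇ-even zero    = refl
oddᵇ-even (suc m) = trans (cong oddᵇ (*-suc 2 m)) (trans (Bool.not-involutive _) (oddᵇ-even m))

module _ (m : ℕ) (i : Fin (suc (2 * m))) where

  -- Without `i` the odd cycle is a path. Alternating colours fail only on the wrap-around edge from
  -- 2m to 0; flipping the part before `i` repairs that edge, and the flip changes only at the
  -- removed vertex.
  cut : Fin (suc (2 * m)) → Bool
  cut a = oddᵇ (toℕ a) xor does (toℕ a <? toℕ i)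

  cut-next : ∀ a b → suc (toℕ a) % suc (2 * m) ≡ toℕ b → a ≢ i → b ≢ i → cut a ≢ cut b
  cut-next a b e a≢i b≢i eq with next-cases (2 * m) a b e
  ... | inj₁ b≡1+a = Bool.not-¬ (sym eq) flipped
    where
    same-side : does (toℕ b <? toℕ i) ≡ does (toℕ a <? toℕ i)
    same-side with toℕ a <? toℕ i
    ... | yes a<i = trans (dec-true (toℕ b <? toℕ i) (≤∧≢⇒< (≤-trans (≤-reflexive b≡1+a) a<i) (b≢i ∘ Fin.toℕ-injective))) (sym (dec-true (toℕ a <? toℕ i) a<i))
    ... | no a≮i = trans (dec-false (toℕ b <? toℕ i) λ b<i → a≮i (≤-trans (s≤s (≤-trans (n≤1+n _) (≤-reflexive (sym b≡1+a)))) b<i)) (sym (dec-false (toℕ a <? toℕ i) a≮i))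
    flipped : cut b ≡ not (cut a)
    flipped = trans (cong₂ _xor_ (cong oddᵇ b≡1+a) same-side) (sym (Bool.not-distribˡ-xor (oddᵇ (toℕ a)) _))
  ... | inj₂ (a≡2m , refl) = case trans (sym at-a) (trans eq at-b) of λ ()
    where
    at-a : cut a ≡ false
    at-a = cong₂ _xor_ (trans (cong oddᵇ a≡2m) (oddᵇ-even m))
      (dec-false (toℕ a <? toℕ i) λ a<i → <⇒≱ a<i (≤-trans (s≤s⁻¹ (Fin.toℕ<n i)) (≤-reflexive (sym a≡2m))))
    at-b : cut (Fin.zero {2 * m}) ≡ true
    at-b = dec-true (0 <? toℕ i) (≤∧≢⇒< z≤n (b≢i ∘ Fin.toℕ-injective))

  cut-proper : ∀ a b → Cyc (2 * m) a b ≡ true → a ≢ i → b ≢ i → cut a ≢ cut b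
  cut-proper a b e a≢i b≢i with Cyc-step (2 * m) a b e
  ... | inj₁ p = cut-next a b p a≢i b≢i
  ... | inj₂ p = cut-next b a p b≢i a≢i ∘ sym

-- Too few vertices to cover the cycle: the image lies in a path, which is bipartite. This
-- guarantees that the search for `g` ends.
no-long-cycle : ∀ {k} (H : Graph k) → ¬ Hom H (K 2) → ∀ m → k ≤ m → ¬ Hom H (Cyc (2 * m))
no-long-cycle H ¬two m k≤m (φ , hom) with missed (s≤s (≤-trans k≤m (m≤m+n m _))) φ
... | i , miss = ¬two (side ∘ cut m i ∘ φ , λ u v e →
  side-proper _ _ (cut-proper m i (φ u) (φ v) (hom u v e) (miss u) (miss v)))

least : ∀ {P : ℕ → Set} → (∀ m → Dec (P m)) → ∀ b → P b → ∃ λ m → P m × (∀ j → j < m → ¬ P j)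
least P? zero p = 0 , p , λ _ ()
least {P} P? (suc b) p with P? 0
... | yes p₀ = 0 , p₀ , λ _ ()
... | no ¬p₀ with least {P ∘ suc} (P? ∘ suc) b p
...   | m , q , min = suc m , q , λ { zero _ → ¬p₀ ; (suc j) (s≤s lt) → min j lt }

odd-cycle-not-bipartite : ∀ g (c : Fin (suc (2 * g)) → Bool) → (∀ i j → Cyc (2 * g) i j ≡ true → c i ≢ c j) → ⊥
odd-cycle-not-bipartite g c proper = proper last zero edge (trans (alternate last) (cong (λ t → t xor c zero)
    (trans (cong oddᵇ (Fin.toℕ-fromℕ (2 * g))) (oddᵇ-even g))))
  where
  last = Fin.fromℕ (2 * g)
  edge : Cyc (2 * g) last zero ≡ true
  edge = Cyc-next (2 * g) last zero (trans (cong (λ t → suc t % suc (2 * g)) (Fin.toℕ-fromℕ (2 * g))) (n%n≡0 (suc (2 * g))))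
  along : ∀ m (m<L : m < suc (2 * g)) → c (Fin.fromℕ< m<L) ≡ oddᵇ m xor c zero
  along zero    (s≤s _) = refl
  along (suc m) 1+m<L = trans (Bool.¬-not (proper (Fin.fromℕ< m<L) (Fin.fromℕ< 1+m<L) (Cyc-next (2 * g) _ _
      (trans (cong (λ t → suc t % suc (2 * g)) (Fin.toℕ-fromℕ< m<L)) (trans (m<n⇒m%n≡m 1+m<L) (sym (Fin.toℕ-fromℕ< 1+m<L))))) ∘ sym))
    (trans (cong not (along m m<L)) (Bool.not-distribˡ-xor (oddᵇ m) (c zero)))
    where m<L = ≤-trans (n≤1+n (suc m)) 1+m<L
  alternate : ∀ i → c i ≡ oddᵇ (toℕ i) xor c zero
  alternate i = trans (cong c (sym (Fin.fromℕ<-toℕ i (Fin.toℕ<n i)))) (along (toℕ i) (Fin.toℕ<n i))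

-- The blow-up of an odd cycle

sum-++ : ∀ a b (f : Fin (a + b) → ℕ) → sumF f ≡ sumF (λ x → f (x ↑ˡ b)) + sumF (λ y → f (a ↑ʳ y))
sum-++ zero    b f = refl
sum-++ (suc a) b f = trans (cong (f zero +_) (sum-++ a b (f ∘ suc))) (sym (+-assoc (f zero) _ _))

sum-combine : ∀ l m (f : Fin (l * m) → ℕ) → sumF f ≡ sumF (λ i → sumF (λ a → f (combine {l} i a)))
sum-combine zero    m f = refl
sum-combine (suc l) m f = trans (sum-++ m (l * m) f)
  (cong (sumF (λ a → f (a ↑ˡ (l * m))) +_) (sum-combine l m (λ y → f (m ↑ʳ y))))

Cyc-sym : ∀ m i j → Cyc m i j ≡ Cyc m j i
Cyc-sym m i j = Bool.∨-comm (suc (toℕ i) % suc m ≡ᵇ toℕ j) _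

next : ∀ m (p : Fin (suc m)) → ∃ λ (x : Fin (suc m)) → suc (toℕ p) % suc m ≡ toℕ x
next m p = Fin.fromℕ< (m%n<n (suc (toℕ p)) (suc m)) , sym (Fin.toℕ-fromℕ< _)

previous : ∀ m (p : Fin (suc m)) → ∃ λ (x : Fin (suc m)) → suc (toℕ x) % suc m ≡ toℕ p
previous m zero = Fin.fromℕ m , trans (cong (λ t → suc t % suc m) (Fin.toℕ-fromℕ m)) (n%n≡0 (suc m))
previous m (suc p) = Fin.inject₁ p , trans (cong (λ t → suc t % suc m) (Fin.toℕ-inject₁ p)) (m<n⇒m%n≡m (s≤s (Fin.toℕ<n p)))

next≢previous : ∀ m → 2 ≤ m → ∀ p x → suc (toℕ p) % suc m ≡ toℕ x → suc (toℕ x) % suc m ≡ toℕ p → ⊥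
next≢previous m 2≤m p x e e′ with next-cases m p x e | next-cases m x p e′
... | inj₁ q | inj₁ r = <⇒≢ (≤-trans (n≤1+n _) (≤-reflexive (trans (cong suc (sym r)) (sym q)))) refl
... | inj₁ q | inj₂ (r , refl) = <⇒≢ 2≤m (trans (sym q) r)
... | inj₂ (q , refl) | inj₁ r = <⇒≢ 2≤m (trans (sym r) q)
... | inj₂ (q , refl) | inj₂ (r , refl) = <⇒≢ (≤-trans (s≤s z≤n) 2≤m) r

δ-pair : ∀ {n} (b : Fin n → Bool) x y → x ≢ y → b x ≡ true → b y ≡ true → ∀ i → δ x i + δ y i ≤ ⟦ b i ⟧
δ-pair b x y x≢y bx by i with x Fin.≟ i | y Fin.≟ i
... | no _    | no _    = z≤n
... | yes x≡i | no _    = ≤-reflexive (sym (cong ⟦_⟧ (trans (cong b (sym x≡i)) bx)))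
... | no _    | yes y≡i = ≤-reflexive (sym (cong ⟦_⟧ (trans (cong b (sym y≡i)) by)))
... | yes x≡i | yes y≡i = ⊥-elim (x≢y (trans x≡i (sym y≡i)))

Cyc-degree : ∀ m → 2 ≤ m → ∀ p → 2 ≤ sumF (λ i → ⟦ Cyc m p i ⟧)
Cyc-degree m 2≤m p = begin
  2                              ≡⟨ cong₂ _+_ (sum-δ x) (sum-δ y) ⟨
  sumF (δ x) + sumF (δ y)        ≡⟨ sum-+ (δ x) (δ y) ⟨
  sumF (λ i → δ x i + δ y i)     ≤⟨ sum-mono (δ-pair (Cyc m p) x y x≢y (Cyc-next m p x ex)
                                      (trans (Cyc-sym m p y) (Cyc-next m y p ey))) ⟩
  sumF (λ i → ⟦ Cyc m p i ⟧)     ∎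
  where
  x = proj₁ (next m p)
  ex = proj₂ (next m p)
  y = proj₁ (previous m p)
  ey = proj₂ (previous m p)
  x≢y : x ≢ y
  x≢y x≡y = next≢previous m 2≤m p x ex (trans (cong (λ t → suc (toℕ t) % suc m) x≡y) ey)

module BlowUp (g m : ℕ) (1≤g : 1 ≤ g) where

  L : ℕ
  L = suc (2 * g)

  2≤2g : 2 ≤ 2 * g
  2≤2g = *-monoʳ-≤ 2 1≤g

  part : Fin (L * m) → Fin L
  part = quotient {L} m

  node : Fin L → Fin m → Fin (L * m)
  node = combine

  part-node : ∀ i a → part (node i a) ≡ i
  part-node i a = cong proj₁ (Fin.remQuot-combine {L} i a)

  blowUp : Graph (L * m)
  blowUp = record
    { adj = λ u v → Cyc (2 * g) (part u) (part v)
    ; sym = λ u v → Cyc-sym (2 * g) (part u) (part v)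
    ; irr = λ u → Cyc-irr (2 * g) (≤-trans (s≤s z≤n) 2≤2g) (part u)
    }

  blowUp-free : ∀ {k} (H : Graph k) → ¬ Hom H (Cyc (2 * g)) → Free H blowUp
  blowUp-free H ¬hom (f , _ , hom) = ¬hom (part ∘ f , hom)

  blowUp-degree : ∀ v → m * 2 ≤ deg blowUp v
  blowUp-degree v = begin
    m * 2                                                    ≤⟨ *-monoʳ-≤ m (Cyc-degree (2 * g) 2≤2g (part v)) ⟩
    m * sumF (λ i → ⟦ Cyc (2 * g) (part v) i ⟧)              ≡⟨ sum-*ˡ m (λ i → ⟦ Cyc (2 * g) (part v) i ⟧) ⟨
    sumF (λ i → m * ⟦ Cyc (2 * g) (part v) i ⟧)              ≡⟨ sum-cong (λ i → trans (sum-cong λ a → cong (λ t → ⟦ Cyc (2 * g) (part v) t ⟧) (part-node i a)) (sum-const m _)) ⟨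
    sumF (λ i → sumF (λ a → ⟦ adj blowUp v (node i a) ⟧)) ≡⟨ sum-combine L m (λ u → ⟦ adj blowUp v u ⟧) ⟨
    sumF (λ u → ⟦ adj blowUp v u ⟧)                          ≡⟨ count-sum (adj blowUp v) ⟨
    deg blowUp v                                             ∎

  module _ (G′ : Graph (L * m)) (φ : Hom G′ (K 2)) where

    χ : Fin L → Fin m → Bool
    χ i a = side⁻¹ (proj₁ φ (node i a))

    N : Fin L → Bool → ℕ
    N i σ = sumF (λ a → ⟦ same (χ i a) σ ⟧)

    N-total : ∀ i → N i false + N i true ≡ m
    N-total i = trans (sym (sum-+ (λ a → ⟦ same (χ i a) false ⟧) (λ a → ⟦ same (χ i a) true ⟧)))
      (trans (sum-cong λ a → one (χ i a)) (trans (sum-const m 1) (*-identityʳ m)))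
      where one : ∀ b → ⟦ same b false ⟧ + ⟦ same b true ⟧ ≡ 1
            one true  = refl
            one false = refl

    majority : Fin L → Bool
    majority i = does (N i false ≤? N i true)

    majority-half : ∀ i → m ≤ 2 * N i (majority i)
    majority-half i with majority i in eq
    ... | true  = ≤-trans (≤-reflexive (sym (N-total i))) (≤-trans (+-monoˡ-≤ _ (does⇒ (N i false ≤? N i true) eq)) (≤-reflexive (double (N i true))))
    ... | false = ≤-trans (≤-reflexive (sym (N-total i))) (≤-trans (+-monoʳ-≤ _ (<⇒≤ (≰⇒> (¬does⇒ (N i false ≤? N i true) eq)))) (≤-reflexive (double (N i false))))

    lost : Fin (L * m) → Fin (L * m) → Bool
    lost u v = adj blowUp u v ∧ not (adj G′ u v)

    -- At least m/2 vertices in each of two adjacent parts have the common majority colour, and all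
    -- m²/4 or more edges between them must have been deleted.
    same-majority : ∀ i j → Cyc (2 * g) i j ≡ true → majority i ≡ majority j → m * m ≤ 4 * deletedOrdered blowUp G′
    same-majority i j ij eq = begin
      m * m                                      ≤⟨ *-mono-≤ (majority-half i) (majority-half j) ⟩
      2 * N i (majority i) * (2 * N j (majority j)) ≡⟨ cong (λ t → 2 * N i σ * (2 * N j t)) (sym eq) ⟩
      2 * N i σ * (2 * N j σ)                    ≡⟨ lem (N i σ) (N j σ) ⟩
      4 * (N i σ * N j σ)                        ≤⟨ *-monoʳ-≤ 4 (begin
        N i σ * N j σ                            ≡⟨ sum-*-sum (λ a → ⟦ same (χ i a) σ ⟧) (λ b → ⟦ same (χ j b) σ ⟧) ⟩
        sumF (λ a → sumF (λ b → ⟦ same (χ i a) σ ⟧ * ⟦ same (χ j b) σ ⟧))  ≤⟨ sum-mono (λ a → sum-mono λ b → pointwise a b) ⟩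
        sumF (λ a → sumF (λ b → ⟦ lost (node i a) (node j b) ⟧))     ≤⟨ sum-mono (λ a → term≤sum (λ j → sumF (λ b → ⟦ lost (node i a) (node j b) ⟧)) j) ⟩
        sumF (λ a → sumF (λ j → sumF (λ b → ⟦ lost (node i a) (node j b) ⟧))) ≡⟨ sum-cong (λ a → trans (count-sum (lost (node i a))) (sum-combine L m (λ v → ⟦ lost (node i a) v ⟧))) ⟨
        sumF (λ a → count (lost (node i a)))  ≤⟨ term≤sum (λ i → sumF (λ a → count (lost (node i a)))) i ⟩
        sumF (λ i → sumF (λ a → count (lost (node i a)))) ≡⟨ sum-combine L m (λ u → count (lost u)) ⟨
        deletedOrdered blowUp G′                 ∎) ⟩
      4 * deletedOrdered blowUp G′               ∎
      where
      σ = majority i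
      lem : ∀ a b → 2 * a * (2 * b) ≡ 4 * (a * b)
      lem = solve-∀
      pointwise : ∀ a b → ⟦ same (χ i a) σ ⟧ * ⟦ same (χ j b) σ ⟧ ≤ ⟦ lost (node i a) (node j b) ⟧
      pointwise a b = ⟦⟧-elim _ (same (χ j b) σ) λ q → ≤-trans (≤-reflexive (sym (*-identityˡ _))) (⟦⟧-elim 1 (same (χ i a) σ) λ p →
        ≤-reflexive (sym (cong ⟦_⟧ (cong₂ (λ s t → s ∧ not t)
          (trans (cong₂ (Cyc (2 * g)) (part-node i a) (part-node j b)) ij)
          (Bool.¬-not λ e → side⁻¹-proper _ _ (proj₂ φ (node i a) (node j b) e) (trans (same⇒≡ (χ i a) σ p) (sym (same⇒≡ (χ j b) σ q))))))))

    many-deleted : m * m ≤ 4 * deletedOrdered blowUp G′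
    many-deleted = ≮⇒≥ λ few → odd-cycle-not-bipartite g majority λ i j ij eq → <⇒≱ few (same-majority i j ij eq)

-- Rational thresholds

open import Data.Integer using (+_; -[1+_])

-- The second argument is the denominator minus one, so `n /ᵘ 0` is the integer n.
_/ᵘ_ : ℕ → ℕ → ℚᵘ
a /ᵘ b = mkℚᵘ (+ a) b

/ᵘ-* : ∀ a b c d → (a /ᵘ b) ℚᵘ.* (c /ᵘ d) ℚᵘ.≃ ((a * c) /ᵘ (d + b * suc d))
/ᵘ-* a b c d = *≡* (cong₂ ℤ._*_ (sym (ℤ.pos-* a c)) refl)

≤ᵘ⇒≤ : ∀ a b c d → (a /ᵘ b) ℚᵘ.≤ (c /ᵘ d) → a * suc d ≤ c * suc b
≤ᵘ⇒≤ a b c d (*≤* p) = ℤ.drop‿+≤+ (subst₂ ℤ._≤_ (sym (ℤ.pos-* a (suc d))) (sym (ℤ.pos-* c (suc b))) p)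

≤⇒≤ᵘ : ∀ a b c d → a * suc d ≤ c * suc b → (a /ᵘ b) ℚᵘ.≤ (c /ᵘ d)
≤⇒≤ᵘ a b c d p = *≤* (subst₂ ℤ._≤_ (ℤ.pos-* a (suc d)) (ℤ.pos-* c (suc b)) (ℤ.+≤+ p))

ι-ᵘ : ∀ n → toℚᵘ (ι n) ℚᵘ.≃ (n /ᵘ 0)
ι-ᵘ n = ℚ.toℚᵘ-fromℚᵘ (n /ᵘ 0)

scaled-≤ : ∀ a b .(cop : Coprime a (suc b)) n d → mkℚ (+ a) b cop ℚ.* ι n ℚ.≤ ι d → a * n ≤ suc b * d
scaled-≤ a b cop n d p = begin
  a * n                    ≡⟨ *-identityʳ (a * n) ⟨
  a * n * 1                ≤⟨ ≤ᵘ⇒≤ (a * n) (0 + b * 1) d 0 (ℚᵘ.≤-respˡ-≃ (ℚᵘ.≃-trans (ℚ.toℚᵘ-homo-* c (ι n))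
                                (ℚᵘ.≃-trans (ℚᵘ.*-congˡ {a /ᵘ b} (ι-ᵘ n)) (/ᵘ-* a b n 0)))
                                (ℚᵘ.≤-respʳ-≃ (ι-ᵘ d) (ℚ.toℚᵘ-mono-≤ p))) ⟩
  d * suc (b * 1)          ≡⟨ trans (cong (λ t → d * suc t) (*-identityʳ b)) (*-comm d (suc b)) ⟩
  suc b * d                ∎
  where c = mkℚ (+ a) b cop

≤-scaled : ∀ a b .(cop : Coprime a (suc b)) n d → suc b * d ≤ 2 * a * n → ι d ℚ.≤ ι 2 ℚ.* mkℚ (+ a) b cop ℚ.* ι n
≤-scaled a b cop n d p = ℚ.toℚᵘ-cancel-≤ (ℚᵘ.≤-respˡ-≃ (ℚᵘ.≃-sym (ι-ᵘ d)) (ℚᵘ.≤-respʳ-≃ (ℚᵘ.≃-sym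
    (ℚᵘ.≃-trans (ℚ.toℚᵘ-homo-* (ι 2 ℚ.* c) (ι n)) (ℚᵘ.≃-trans (ℚᵘ.*-cong (ℚᵘ.≃-trans (ℚ.toℚᵘ-homo-* (ι 2) c)
      (ℚᵘ.≃-trans (ℚᵘ.*-congʳ {a /ᵘ b} (ι-ᵘ 2)) (/ᵘ-* 2 0 a b))) (ι-ᵘ n)) (/ᵘ-* (2 * a) (b + 0) n 0))))
    (≤⇒≤ᵘ d 0 (2 * a * n) (0 + (b + 0) * 1) (begin
      d * suc ((b + 0) * 1)  ≡⟨ lem d b ⟩
      suc b * d              ≤⟨ p ⟩
      2 * a * n              ≡⟨ *-identityʳ _ ⟨
      2 * a * n * 1          ∎))))
  where
  c = mkℚ (+ a) b cop
  lem : ∀ d b → d * suc ((b + 0) * 1) ≡ suc b * d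
  lem = solve-∀

≤-unit-fraction : ∀ d t n → ι d ℚ.≤ ι 2 ℚ.* (+ 1 / suc t) ℚ.* ι n → suc t * d ≤ 2 * n
≤-unit-fraction d t n p = begin
  suc t * d                    ≡⟨ lem t d ⟩
  d * suc ((t + 0) * 1)        ≤⟨ ≤ᵘ⇒≤ d 0 (2 * 1 * n) (0 + (t + 0) * 1) (ℚᵘ.≤-respˡ-≃ (ι-ᵘ d) (ℚᵘ.≤-respʳ-≃
      (ℚᵘ.≃-trans (ℚ.toℚᵘ-homo-* (ι 2 ℚ.* η) (ι n)) (ℚᵘ.≃-trans (ℚᵘ.*-cong (ℚᵘ.≃-trans (ℚ.toℚᵘ-homo-* (ι 2) η)
        (ℚᵘ.≃-trans (ℚᵘ.*-cong (ι-ᵘ 2) (ℚ.toℚᵘ-fromℚᵘ (1 /ᵘ t))) (/ᵘ-* 2 0 1 t))) (ι-ᵘ n)) (/ᵘ-* (2 * 1) (t + 0) n 0)))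
      (ℚ.toℚᵘ-mono-≤ p))) ⟩
  2 * n * 1                    ≡⟨ *-identityʳ _ ⟩
  2 * n                        ∎
  where
  η = + 1 / suc t
  lem : ∀ t d → suc t * d ≡ d * suc ((t + 0) * 1)
  lem = solve-∀

unit-fraction>0 : ∀ t → 0ℚ ℚ.< + 1 / suc t
unit-fraction>0 t = ℚ.toℚᵘ-cancel-< (ℚᵘ.<-respʳ-≃ (ℚᵘ.≃-sym (ℚ.toℚᵘ-fromℚᵘ (1 /ᵘ t))) (*<* (ℤ.+<+ (s≤s z≤n))))

two-over-< : ∀ l a b .(cop : Coprime a (suc b)) → + 2 / suc l ℚ.< mkℚ (+ a) b cop → 2 * suc b < a * suc l
two-over-< l a b cop p with ℚᵘ.<-respˡ-≃ (ℚ.toℚᵘ-fromℚᵘ (2 /ᵘ l)) (ℚ.toℚᵘ-mono-< p)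
... | *<* q = ℤ.drop‿+<+ (subst₂ ℤ._<_ (sym (ℤ.pos-* 2 (suc b))) (sym (ℤ.pos-* a (suc l))) q)

two-over-≮-neg : ∀ l a b .(cop : Coprime (suc a) (suc b)) → ¬ (+ 2 / suc l ℚ.< mkℚ -[1+ a ] b cop)
two-over-≮-neg l a b cop p with ℚᵘ.<-respˡ-≃ (ℚ.toℚᵘ-fromℚᵘ (2 /ᵘ l)) (ℚ.toℚᵘ-mono-< p)
... | *<* ()

two-over-scaled : ∀ l m d → m * 2 ≤ d → (+ 2 / suc l) ℚ.* ι (suc l * m) ℚ.≤ ι d
two-over-scaled l m d p = ℚ.toℚᵘ-cancel-≤ (ℚᵘ.≤-respʳ-≃ (ℚᵘ.≃-sym (ι-ᵘ d)) (ℚᵘ.≤-respˡ-≃ (ℚᵘ.≃-sym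
    (ℚᵘ.≃-trans (ℚ.toℚᵘ-homo-* (+ 2 / suc l) (ι (suc l * m))) (ℚᵘ.≃-trans (ℚᵘ.*-cong (ℚ.toℚᵘ-fromℚᵘ (2 /ᵘ l)) (ι-ᵘ (suc l * m)))
      (/ᵘ-* 2 l (suc l * m) 0))))
    (≤⇒≤ᵘ (2 * (suc l * m)) (0 + l * 1) d 0 (begin
      2 * (suc l * m) * 1   ≡⟨ lem l m ⟩
      m * 2 * suc (l * 1)   ≤⟨ *-monoˡ-≤ (suc (l * 1)) p ⟩
      d * suc (l * 1)       ∎))))
  where lem : ∀ l m → 2 * (suc l * m) * 1 ≡ m * 2 * suc (l * 1)
        lem = solve-∀

ι-nonNeg : ∀ n → ℚ.NonNegative (ι n)
ι-nonNeg n = ℚ.normalize-nonNeg n 1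

-- With η = 1/(t+1) and t ≥ 16L², the permitted deletions fall to m²/8, half of the m²/4 forced by
-- `many-deleted`.
eighth : ∀ L m d t → .{{_ : NonZero L}} → 16 * (L * L) ≤ t → suc t * d ≤ 2 * (L * m * (L * m)) → 8 * d ≤ m * m
eighth L m d t 16L²≤t p = *-cancelˡ-≤ (2 * (L * L)) {{m*n≢0 2 (L * L) {{_}} {{m*n≢0 L L}}}} (begin
  2 * (L * L) * (8 * d)       ≡⟨ lem₁ (L * L) d ⟩
  16 * (L * L) * d            ≤⟨ *-monoˡ-≤ d (≤-trans 16L²≤t (n≤1+n t)) ⟩
  suc t * d                   ≤⟨ p ⟩
  2 * (L * m * (L * m))       ≡⟨ lem₂ L m ⟩
  2 * (L * L) * (m * m)       ∎)
  where
  lem₁ : ∀ l d → 2 * l * (8 * d) ≡ 16 * l * d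
  lem₁ = solve-∀
  lem₂ : ∀ l m → 2 * (l * m * (l * m)) ≡ 2 * (l * l) * (m * m)
  lem₂ = solve-∀

-- The two inequalities for the threshold.

blowUp-far : ∀ {k} (H : Graph k) g → 1 ≤ g → ¬ Hom H (Cyc (2 * g)) → ∀ c → c ℚ.< + 2 / suc (2 * g) →
  ∀ t → 16 * (suc (2 * g) * suc (2 * g)) ≤ t → ∀ m → 1 ≤ m →
  ¬ (∀ (G : Graph (suc (2 * g) * m)) → Free H G → MinDegAtLeast G c → AlmostPartite 2 G (+ 1 / suc t))
blowUp-far H g 1≤g ¬hom c c<t t t≥ m 1≤m almost = impossible (almost blowUp (blowUp-free H ¬hom) minDeg)
  where
  open BlowUp g m 1≤g
  minDeg : MinDegAtLeast blowUp c
  minDeg v = ℚ.≤-trans (ℚ.*-monoʳ-≤-nonNeg (ι (L * m)) {{ι-nonNeg (L * m)}} (ℚ.<⇒≤ c<t))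
    (two-over-scaled (2 * g) m (deg blowUp v) (blowUp-degree v))
  impossible : ¬ AlmostPartite 2 blowUp (+ 1 / suc t)
  impossible (G′ , _ , φ , few) = <⇒≱ (m<m+n (m * m) (*-mono-≤ 1≤m 1≤m)) (begin
    m * m + m * m                          ≡⟨ double (m * m) ⟩
    2 * (m * m)                            ≤⟨ *-monoʳ-≤ 2 (many-deleted G′ φ) ⟩
    2 * (4 * deletedOrdered blowUp G′)     ≡⟨ *-assoc 2 4 (deletedOrdered blowUp G′) ⟨
    8 * deletedOrdered blowUp G′           ≤⟨ eighth L m (deletedOrdered blowUp G′) t t≥
                                                (≤-unit-fraction (deletedOrdered blowUp G′) t (L * m * (L * m)) few) ⟩
    m * m                                  ∎)

lower-bound : ∀ {k} (H : Graph k) g → 1 ≤ g → ¬ Hom H (Cyc (2 * g)) →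
  ∀ c → c ℚ.< + 2 / suc (2 * g) → ¬ DeltaProp 2 H c
lower-bound H g 1≤g ¬hom c c<t prop = far (16 * (suc (2 * g) * suc (2 * g))) ≤-refl
  where
  far : ∀ t → 16 * (suc (2 * g) * suc (2 * g)) ≤ t → ⊥
  far t t≥ with prop (+ 1 / suc t) (unit-fraction>0 t)
  ... | n₀ , almost = blowUp-far H g 1≤g ¬hom c c<t t t≥ (suc n₀) (s≤s z≤n)
    (almost (suc (2 * g) * suc n₀) (≤-trans (n≤1+n n₀) (m≤m+n (suc n₀) _)))

drop-monochromatic : ∀ {n} (G : Graph n) (c : Fin n → Bool) → Σ (Graph n) λ G′ → SubgraphOf G′ G × Hom G′ (K 2) ×
  deletedOrdered G G′ ≡ sumF (λ u → sumF λ v → ⟦ adj G u v ∧ same (c u) (c v) ⟧)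
drop-monochromatic G c = G′ , (λ u v → Bool.∧-conicalˡ _ _) ,
  (side ∘ c , λ u v e → side-proper (c u) (c v) (xor⇒≢ (c u) (c v) (Bool.∧-conicalʳ (adj G u v) _ e))) ,
  sum-cong (λ u → trans (count-sum (λ v → adj G u v ∧ not (adj G′ u v))) (sum-cong λ v → cong ⟦_⟧ (lem (adj G u v) (c u xor c v))))
  where
  G′ : Graph _
  G′ = record
    { adj = λ u v → adj G u v ∧ (c u xor c v)
    ; sym = λ u v → cong₂ _∧_ (Graph.sym G u v) (Bool.xor-comm (c u) (c v))
    ; irr = λ v → cong (_∧ (c v xor c v)) (irr G v)
    }
  xor⇒≢ : ∀ a b → a xor b ≡ true → a ≢ b
  xor⇒≢ true  .true  () refl
  xor⇒≢ false .false () refl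
  lem : ∀ a b → a ∧ not (a ∧ b) ≡ a ∧ not b
  lem true  b = refl
  lem false b = refl

free⇒near-bipartite : ∀ {k} (H : Graph k) g → 2 ≤ g → (∀ s → 1 ≤ s → s < g → Hom H (Cyc (2 * s))) →
  ∀ r a e → 1 ≤ r → 2 * r < a * suc (2 * g) → 1 ≤ e → 4 * r * (2 * r) ≤ e →
  ∃ λ n₀ → ∀ n → n₀ ≤ n → (G : Graph n) → Free H G → (∀ v → a * n ≤ r * deg G v) →
  ∃ λ (c : Fin n → Bool) → e * sumF (λ u → sumF λ v → ⟦ adj G u v ∧ same (c u) (c v) ⟧) ≤ (2 + 10 * r) * (n * n)
free⇒near-bipartite {k} H g 2≤g homs r a e 1≤r 2r<aL 1≤e 8r²≤e = suc n₀ , result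
  where
  D D₀ n₀ : ℕ
  D = e * e * weight e
  D₀ = amplify r (suc e) D
  -- The length 2g+1 exceeds that of every cycle used below, so one bound on n serves them all.
  n₀ = towerSquare k D₀ * ((k + suc (2 * g)) * (k + suc (2 * g)))
  1≤a : 1 ≤ a
  1≤a = n≢0⇒n>0 λ { refl → case 2r<aL of λ () }
  result : ∀ n → suc n₀ ≤ n → (G : Graph n) → Free H G → (∀ v → a * n ≤ r * deg G v) →
    ∃ λ (c : Fin n → Bool) → e * sumF (λ u → sumF λ v → ⟦ adj G u v ∧ same (c u) (c v) ⟧) ≤ (2 + 10 * r) * (n * n)
  result n n₀<n G free degs = near-bipartite few
    where
    instance
      n≢0 : NonZero n
      n≢0 = >-nonZero (≤-trans (s≤s z≤n) n₀<n)
    open Walks G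
    degs₁ : ∀ v → n ≤ r * deg G v
    degs₁ v = ≤-trans (m≤n*m n a {{>-nonZero 1≤a}}) (degs v)
    -- With c = a/r, the strict inequality c > 2/(2g+1) between integers gives 2r+1 ≤ a(2g+1), so
    -- the surplus 1/E of the descent can be taken with E = r.
    degs₂ : ∀ v → suc (2 * r) * n ≤ r * suc (2 * g) * deg G v
    degs₂ v = begin
      suc (2 * r) * n              ≤⟨ *-monoˡ-≤ n 2r<aL ⟩
      a * suc (2 * g) * n          ≡⟨ lem₁ a (suc (2 * g)) n ⟩
      suc (2 * g) * (a * n)        ≤⟨ *-monoʳ-≤ (suc (2 * g)) (degs v) ⟩
      suc (2 * g) * (r * deg G v)  ≡⟨ lem₂ (suc (2 * g)) r (deg G v) ⟩
      r * suc (2 * g) * deg G v    ∎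
      where
      lem₁ : ∀ a l n → a * l * n ≡ l * (a * n)
      lem₁ = solve-∀
      lem₂ : ∀ l r d → l * (r * d) ≡ r * l * d
      lem₂ = solve-∀
    h₁ : h 1 ≡ 0
    h₁ = trans (sum-cong λ v → trans (W-1 v v) (cong ⟦_⟧ (irr G v))) (sum-0 n)
    short : ∀ s → s < g → D₀ * h (suc (2 * s)) ≤ n ^ suc (2 * s)
    -- Length 1 is free: a simple graph has no loops.
    short zero    s<g = ≤-trans (≤-reflexive (trans (cong (D₀ *_) h₁) (*-zeroʳ D₀))) z≤n
    short (suc s) s<g = ClosedWalks.free⇒few-closed-walks G (2 * suc s) (s≤s z≤n) H (homs (suc s) (s≤s z≤n) s<g) free D₀
      (≤-trans (s≤s (*-monoʳ-≤ (towerSquare k D₀) (*-mono-≤ le le))) n₀<n)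
      where
      le : k + suc (2 * suc s) ≤ k + suc (2 * g)
      le = +-monoʳ-≤ k (s≤s (*-monoʳ-≤ 2 (<⇒≤ s<g)))
    all-short : ∀ s → s < suc e → D * h (suc (2 * s)) ≤ n ^ suc (2 * s)
    all-short = Descent.few-odd-walks G g r 2≤g 1≤r degs₂ (suc e) D short
    few : ∀ L → L ≤ suc (e + e) → oddᵇ L ≡ true → D * h L ≤ n ^ L
    few L L≤ o with halve L
    ... | even s = case trans (sym o) (oddᵇ-even s) of λ ()
    ... | odd s  = all-short s (s≤s (*-cancelˡ-≤ 2 (≤-trans (s≤s⁻¹ L≤) (≤-reflexive (double e)))))
    open Cover G e 1≤e
    open Greedy r degs₁ 8r²≤e

-- The factor 1+5r cancels the constant of `near-bipartite`, `suc y` is the denominator of η, and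
-- `t` secures 8r² ≤ e.
precision : ∀ r y → ∃ λ e → 1 ≤ e × 4 * r * (2 * r) ≤ e × (∀ d m → e * d ≤ (2 + 10 * r) * m → suc y * d ≤ 2 * m)
precision r y = e , ≤-trans (s≤s z≤n) t≤e , ≤-trans (n≤1+n _) t≤e , λ d m p → *-cancelˡ-≤ (1 + 5 * r) (begin
    (1 + 5 * r) * (suc y * d)         ≤⟨ *-monoʳ-≤ (1 + 5 * r) (*-monoˡ-≤ d (m≤m*n (suc y) t)) ⟩
    (1 + 5 * r) * (suc y * t * d)     ≡⟨ *-assoc (1 + 5 * r) (suc y * t) d ⟨
    e * d                             ≤⟨ p ⟩
    (2 + 10 * r) * m                  ≡⟨ lem r m ⟩
    (1 + 5 * r) * (2 * m)             ∎)
  where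
  t = suc (4 * r * (2 * r))
  e = (1 + 5 * r) * (suc y * t)
  t≤e : t ≤ e
  t≤e = ≤-trans (m≤n*m t (suc y)) (m≤n*m (suc y * t) (1 + 5 * r))
  lem : ∀ r m → (2 + 10 * r) * m ≡ (1 + 5 * r) * (2 * m)
  lem = solve-∀

few-monochromatic⇒AlmostPartite : ∀ {n} (G : Graph n) x y .(cop : Coprime (suc x) (suc y)) (c : Fin n → Bool) →
  suc y * sumF (λ u → sumF λ v → ⟦ adj G u v ∧ same (c u) (c v) ⟧) ≤ 2 * (n * n) →
  AlmostPartite 2 G (mkℚ (+ suc x) y cop)
few-monochromatic⇒AlmostPartite {n} G x y cop c few with drop-monochromatic G c
... | G′ , sub , hom , del = G′ , sub , hom , ≤-scaled (suc x) y cop (n * n) (deletedOrdered G G′) (begin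
  suc y * deletedOrdered G G′   ≡⟨ cong (suc y *_) del ⟩
  suc y * _                     ≤⟨ few ⟩
  2 * (n * n)                   ≤⟨ *-monoˡ-≤ (n * n) (*-monoʳ-≤ 2 {1} {suc x} (s≤s z≤n)) ⟩
  2 * suc x * (n * n)           ∎)

upper-bound : ∀ {k} (H : Graph k) g → 2 ≤ g → (∀ s → 1 ≤ s → s < g → Hom H (Cyc (2 * s))) →
  ∀ c → + 2 / suc (2 * g) ℚ.< c → DeltaProp 2 H c
upper-bound H g 2≤g homs (mkℚ -[1+ a ] b cop) t<c = ⊥-elim (two-over-≮-neg (2 * g) a b cop t<c)
upper-bound H g 2≤g homs (mkℚ (+ a) b cop) t<c (mkℚ -[1+ _ ] _ _) (*<* ())
upper-bound H g 2≤g homs (mkℚ (+ a) b cop) t<c (mkℚ (+ zero) _ _) (*<* (ℤ.+<+ ()))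
upper-bound H g 2≤g homs (mkℚ (+ a) b cop) t<c (mkℚ (+ suc x) y cop′) _ = at-precision (precision (suc b) y)
  where
  at-precision : (∃ λ e → 1 ≤ e × 4 * suc b * (2 * suc b) ≤ e × (∀ d m → e * d ≤ (2 + 10 * suc b) * m → suc y * d ≤ 2 * m)) →
    Σ ℕ λ n₀ → ∀ n → n₀ ≤ n → (G : Graph n) → Free H G → MinDegAtLeast G (mkℚ (+ a) b cop) →
    AlmostPartite 2 G (mkℚ (+ suc x) y cop′)
  at-precision (e , 1≤e , 8r²≤e , precise) = proj₁ near , λ n n₀≤n G free minDeg →
    let c , few = proj₂ near n n₀≤n G free (λ v → scaled-≤ a b cop n (deg G v) (minDeg v))
    in few-monochromatic⇒AlmostPartite G x y cop′ c (precise _ (n * n) few)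
    where near = free⇒near-bipartite H g 2≤g homs (suc b) a e (s≤s z≤n) (two-over-< (2 * g) a b cop t<c) 1≤e 8r²≤e

triangle : ∀ i j → K 3 i j ≡ true → Cyc 2 i j ≡ true
triangle zero             (suc zero)       _ = refl
triangle zero             (suc (suc zero)) _ = refl
triangle (suc zero)       zero             _ = refl
triangle (suc zero)       (suc (suc zero)) _ = refl
triangle (suc (suc zero)) zero             _ = refl
triangle (suc (suc zero)) (suc zero)       _ = refl
triangle zero             zero             ()
triangle (suc zero)       (suc zero)       ()
triangle (suc (suc zero)) (suc (suc zero)) ()

theorem1p3 : ∀ {k} (H : Graph k) → ChromaticNumber H 3 →
    Σ ℕ λ g → 1 ≤ g × ¬ Hom H (Cyc (2 * g)) ×
    (∀ g′ → 1 ≤ g′ → g′ < g → Hom H (Cyc (2 * g′))) ×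
    DeltaHIs 2 H (+ 2 / suc (2 * g))
theorem1p3 {k} H ((φ , hom) , ¬two) with least (λ m → ¬? (hom? H (Cyc (2 * suc m)))) k (no-long-cycle H ¬two (suc k) (n≤1+n k))
-- A 3-colouring is a homomorphism into the triangle, so g = 1 is impossible; the resulting g ≥ 2 is
-- what `short-odd-arc` relies on.
... | zero , ¬tri , _ = ⊥-elim (¬tri (φ , λ u v e → triangle (φ u) (φ v) (hom u v e)))
... | suc m , ¬hom , min = 2 + m , s≤s z≤n , ¬hom , homs ,
  upper-bound H (2 + m) (s≤s (s≤s z≤n)) homs , lower-bound H (2 + m) (s≤s z≤n) ¬hom
  where
  homs : ∀ g′ → 1 ≤ g′ → g′ < 2 + m → Hom H (Cyc (2 * g′))
  homs (suc g′) _ (s≤s lt) with hom? H (Cyc (2 * suc g′))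
  ... | yes p = p
  ... | no ¬p = ⊥-elim (min g′ lt ¬p)
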